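{- Let $m_1, m_2, m_3$ be positive integers and let $T_1, T_2, T_3$ be any tournaments on $m_1, m_2, m_3$ vertices respectively. Let $H$ be the number of Hamilton cycles in the tournament $C_3(T_1,T_2,T_3)$. Then $$H \;\geq\; \sum_{k=1}^{\min\{m_1,m_2,m_3\}} S(m_1,k)\,S(m_2,k)\,S(m_3,k)\,\frac{(k!)^3}{k},$$ and equality holds when $T_1$, $T_2$ and $T_3$ are all transitive.
   Context: A tournament is an oriented complete graph on a finite vertex set: for every pair of distinct vertices $u,v$ exactly one of the directed edges $u\to v$, $v\to u$ is present (and there are no loops). A tournament is transitive if it contains no directed cycle. A Hamilton cycle in a tournament $T$ is a directed cycle in $T$ passing through every vertex of $T$ exactly once; Hamilton cycles are counted as subgraphs (sets of directed edges), so cyclic shifts of a vertex listing give the same cycle. Given tournaments $T_1, T_2, T_3$ on pairwise disjoint vertex sets, $C_3(T_1,T_2,T_3)$ denotes the tournament whose vertex set is the union of the three vertex sets, which contains all directed edges of $T_1$, $T_2$, $T_3$, and in which every edge between different parts is oriented from $T_1$ to $T_2$, from $T_2$ to $T_3$, and from $T_3$ to $T_1$. $S(m,k)$ denotes the Stirling number of the second kind, i.e. the number of set partitions of $\{1,2,\dots,m\}$ into exactly $k$ nonempty parts. -}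

module Defs where

open import Data.Bool.Base using (true; false)
import Data.Bool.Properties as Bool
open import Data.Empty using (⊥)
open import Data.Unit.Base using (⊤; tt)
open import Data.Fin.Base using (Fin)
import Data.Fin.Properties as Fin
open import Data.Fin.Properties using (+↔⊎)
open import Data.Fin.Subset using (Subset; Nonempty; Empty; _∩_) renaming (_∈_ to _∈ˢ_)
open import Data.Fin.Subset.Properties using (nonempty?) renaming (_∈?_ to _∈ˢ?_)
open import Data.List.Base
  using (List; []; _∷_; [_]; _∷ʳ_; length; map; zip; filter; allFin;
         deduplicate; cartesianProductWith)
open import Data.List.Membership.Propositional using (_∈_)
import Data.List.Membership.DecPropositional as DecMembership
open import Data.List.Properties using (≡-dec)
open import Data.List.Relation.Binary.Subset.Propositional using (_⊆_)
import Data.List.Relation.Binary.Subset.DecPropositional as DecSubset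
open import Data.List.Relation.Unary.All using (All; all?)
open import Data.List.Relation.Unary.AllPairs using (AllPairs; allPairs?)
open import Data.List.Relation.Unary.Any using (Any; any?)
open import Data.List.Relation.Unary.Unique.Propositional using (Unique)
import Data.List.Relation.Unary.Unique.DecPropositional as DecUnique
open import Data.Nat.Base using (ℕ; zero; suc; _+_)
open import Data.Product.Base using (_×_; _,_; uncurry)
import Data.Product.Properties as Product
open import Data.Sum.Base using (_⊎_; inj₁; inj₂)
open import Data.Sum.Properties using (inj₁-injective; inj₂-injective)
open import Data.Sum.Function.Propositional using (_⊎-↔_)
open import Data.Vec.Base using ([]; _∷_)
import Data.Vec.Properties as Vec
open import Function.Base using (_∘_; id)
open import Function.Bundles using (_↔_; module Inverse)
open import Function.Construct.Composition using (_↔-∘_)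
open import Relation.Binary.Consequences using (tri⇒dec≈; tri⇒dec<)
open import Relation.Binary.Definitions
  using (Decidable; DecidableEquality; Trichotomous; tri<; tri≈; tri>)
open import Relation.Binary.PropositionalEquality using (_≡_; _≢_; refl; cong; subst)
open import Relation.Nullary.Decidable using (Dec; map′; ¬?; _×-dec_)
open import Relation.Nullary.Negation using (¬_)

private
  variable
    A : Set
    l m n : ℕ

words : ℕ → List A → List (List A)
words zero    xs = [ [] ]
words (suc n) xs = cartesianProductWith _∷_ xs (words n xs)

SameSet : List A → List A → Set
SameSet xs ys = xs ⊆ ys × ys ⊆ xs

sameSet? : DecidableEquality A → Decidable (SameSet {A})
sameSet? _≟_ xs ys = (xs ⊆? ys) ×-dec (ys ⊆? xs)
  where open DecSubset _≟_ using (_⊆?_)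

-- Each list stands for the set of its entries; a set listed several times
-- is counted once.
countSets : DecidableEquality A → List (List A) → ℕ
countSets _≟_ = length ∘ deduplicate (sameSet? _≟_)

subsets : (m : ℕ) → List (Subset m)
subsets zero    = [ [] ]
subsets (suc m) = cartesianProductWith _∷_ (true ∷ false ∷ []) (subsets m)

-- Since parts are nonempty and disjoint, they are distinct, so the number
-- of parts is the length of the list.
IsPartition : List (Subset m) → Set
IsPartition ps =
  All Nonempty ps ×
  AllPairs (λ p q → Empty (p ∩ q)) ps ×
  (∀ i → Any (i ∈ˢ_) ps)

isPartition? : (ps : List (Subset m)) → Dec (IsPartition ps)
isPartition? ps =
  all? nonempty? ps ×-dec
  allPairs? (λ p q → ¬? (nonempty? (p ∩ q))) ps ×-dec
  Fin.all? (λ i → any? (i ∈ˢ?_) ps)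

-- Stirling numbers of the second kind.
S : ℕ → ℕ → ℕ
S m k = countSets (Vec.≡-dec Bool._≟_) (filter isPartition? (words k (subsets m)))

-- `Trichotomous _≡_ _⟶_` says that for all u and v exactly one of u ⟶ v,
-- u ≡ v and v ⟶ u holds.
record Tournament (n : ℕ) : Set₁ where
  infix 4 _⟶_
  field
    Vertex  : Set
    finite  : Fin n ↔ Vertex
    _⟶_     : Vertex → Vertex → Set
    compare : Trichotomous _≡_ _⟶_

  _≟_ : DecidableEquality Vertex
  _≟_ = tri⇒dec≈ compare

  _⟶?_ : Decidable _⟶_
  _⟶?_ = tri⇒dec< compare

  vertices : List Vertex
  vertices = map (Inverse.to finite) (allFin n)

-- The directed edges traversed by the closed walk through v₁ , … , vₖ:
-- (v₁ , v₂) , … , (vₖ₋₁ , vₖ) , (vₖ , v₁).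
arcs : List A → List (A × A)
arcs []       = []
arcs (v ∷ vs) = zip (v ∷ vs) (vs ∷ʳ v)

module _ (T : Tournament n) where
  open Tournament T

  record IsDirectedCycle (vs : List Vertex) : Set where
    constructor isDirectedCycle
    field
      nonempty : vs ≢ []
      distinct : Unique vs
      edges    : All (uncurry _⟶_) (arcs vs)

  IsTransitive : Set
  IsTransitive = ∀ vs → ¬ IsDirectedCycle vs

  record IsHamiltonCycle (vs : List Vertex) : Set where
    constructor isHamiltonCycle
    field
      cycle    : IsDirectedCycle vs
      spanning : ∀ v → v ∈ vs

  isDirectedCycle? : (vs : List Vertex) → Dec (IsDirectedCycle vs)
  isDirectedCycle? vs =
    map′ (λ (a , b , c) → isDirectedCycle a b c)
         (λ (isDirectedCycle a b c) → a , b , c)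
         (¬? (≡-dec _≟_ vs []) ×-dec
          DecUnique.unique? _≟_ vs ×-dec
          all? (λ (u , v) → u ⟶? v) (arcs vs))

  spanning? : (vs : List Vertex) → Dec (∀ v → v ∈ vs)
  spanning? vs =
    map′ (λ h v → subst (_∈ vs) (Inverse.strictlyInverseˡ finite v)
                        (h (Inverse.from finite v)))
         (_∘ Inverse.to finite)
         (Fin.all? (λ i → DecMembership._∈?_ _≟_ (Inverse.to finite i) vs))

  isHamiltonCycle? : (vs : List Vertex) → Dec (IsHamiltonCycle vs)
  isHamiltonCycle? vs =
    map′ (λ (c , s) → isHamiltonCycle c s)
         (λ (isHamiltonCycle c s) → c , s)
         (isDirectedCycle? vs ×-dec spanning? vs)

  -- A listing with distinct entries that meets every vertex has length n.
  hamiltonListings : List (List Vertex)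
  hamiltonListings = filter isHamiltonCycle? (words n vertices)

  -- Listings with the same set of directed edges are the same Hamilton cycle.
  #HamiltonCycles : ℕ
  #HamiltonCycles = countSets (Product.≡-dec _≟_ _≟_) (map arcs hamiltonListings)

pattern in₁ u = inj₁ u
pattern in₂ u = inj₂ (inj₁ u)
pattern in₃ u = inj₂ (inj₂ u)

module _ (T₁ : Tournament l) (T₂ : Tournament m) (T₃ : Tournament n) where
  private
    module T₁ = Tournament T₁
    module T₂ = Tournament T₂
    module T₃ = Tournament T₃

  C₃-Vertex : Set
  C₃-Vertex = T₁.Vertex ⊎ (T₂.Vertex ⊎ T₃.Vertex)

  C₃-Edge : C₃-Vertex → C₃-Vertex → Set
  C₃-Edge (in₁ u) (in₁ v) = u T₁.⟶ v
  C₃-Edge (in₂ u) (in₂ v) = u T₂.⟶ v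
  C₃-Edge (in₃ u) (in₃ v) = u T₃.⟶ v
  C₃-Edge (in₁ _) (in₂ _) = ⊤
  C₃-Edge (in₂ _) (in₃ _) = ⊤
  C₃-Edge (in₃ _) (in₁ _) = ⊤
  C₃-Edge (in₂ _) (in₁ _) = ⊥
  C₃-Edge (in₃ _) (in₂ _) = ⊥
  C₃-Edge (in₁ _) (in₃ _) = ⊥

  C₃-compare : Trichotomous _≡_ C₃-Edge
  C₃-compare (in₁ u) (in₁ v) with T₁.compare u v
  ... | tri< a ¬b ¬c = tri< a (¬b ∘ inj₁-injective) ¬c
  ... | tri≈ ¬a b ¬c = tri≈ ¬a (cong inj₁ b) ¬c
  ... | tri> ¬a ¬b c = tri> ¬a (¬b ∘ inj₁-injective) c
  C₃-compare (in₂ u) (in₂ v) with T₂.compare u v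
  ... | tri< a ¬b ¬c = tri< a (¬b ∘ inj₁-injective ∘ inj₂-injective) ¬c
  ... | tri≈ ¬a b ¬c = tri≈ ¬a (cong (inj₂ ∘ inj₁) b) ¬c
  ... | tri> ¬a ¬b c = tri> ¬a (¬b ∘ inj₁-injective ∘ inj₂-injective) c
  C₃-compare (in₃ u) (in₃ v) with T₃.compare u v
  ... | tri< a ¬b ¬c = tri< a (¬b ∘ inj₂-injective ∘ inj₂-injective) ¬c
  ... | tri≈ ¬a b ¬c = tri≈ ¬a (cong (inj₂ ∘ inj₂) b) ¬c
  ... | tri> ¬a ¬b c = tri> ¬a (¬b ∘ inj₂-injective ∘ inj₂-injective) c
  C₃-compare (in₁ _) (in₂ _) = tri< tt (λ ()) id
  C₃-compare (in₂ _) (in₃ _) = tri< tt (λ ()) id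
  C₃-compare (in₃ _) (in₁ _) = tri< tt (λ ()) id
  C₃-compare (in₂ _) (in₁ _) = tri> id (λ ()) tt
  C₃-compare (in₃ _) (in₂ _) = tri> id (λ ()) tt
  C₃-compare (in₁ _) (in₃ _) = tri> id (λ ()) tt

  C₃ : Tournament (l + (m + n))
  C₃ = record
    { Vertex  = C₃-Vertex
    ; finite  = (T₁.finite ⊎-↔ ((T₂.finite ⊎-↔ T₃.finite) ↔-∘ +↔⊎)) ↔-∘ +↔⊎
    ; _⟶_     = C₃-Edge
    ; compare = C₃-compare
    }

{-# OPTIONS --safe #-}

-- A Hamilton cycle of C₃(T₁, T₂, T₃) winds around the triangle some number k of times, and its
-- arcs inside the parts form a cover of each Tᵢ by k disjoint paths.  Fix a vertex v of T₁ and
-- read the cycle from the start of the path through v: cycles then correspond bijectively to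
-- triples of path covers, each listed in order, with v on the first path of T₁.  By Rédei's
-- theorem every ordered set partition of the vertices of Tᵢ comes from an ordered path cover, and
-- from only one if Tᵢ is transitive.  There are k! S(mᵢ, k) ordered partitions into k parts, of
-- which (k − 1)! S(mᵢ, k) have v in their first part, and (k − 1)! k! k! = (k!)³ / k.

module Submission where

open import Defs
open import Data.Bool.Base using (true; false)
import Data.Bool.Properties as Bool
open import Data.Empty using (⊥; ⊥-elim)
open import Data.Fin.Base using (Fin; fromℕ<)
open import Data.Fin.Subset using (Subset; Nonempty; Empty; _∩_) renaming (_∈_ to _∈ˢ_)
open import Data.Fin.Subset.Properties
  using (x∈p∩q⁺; x∈p∩q⁻; ⊆-antisym) renaming (_∈?_ to _∈ˢ?_)
open import Data.List.Base
  using (List; []; _∷_; [_]; _∷ʳ_; _++_; length; map; concat; concatMap; filter; zip; allFin;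
         deduplicate; cartesianProduct; sum; upTo)
open import Data.List.Membership.Propositional using (_∈_; _∉_; find; lose)
import Data.List.Membership.DecPropositional as DecMembership
open import Data.List.Membership.Propositional.Properties hiding (finite)
open import Data.List.Membership.Propositional.Properties.WithK using (unique∧set⇒bag)
open import Data.List.Properties
  using (∷-injective; ++-assoc; ++-identityʳ; length-++; length-map; length-tabulate;
         map-++; map-cong; map-id; map-injective; map-∘)
open import Data.List.Relation.Binary.BagAndSetEquality using (∼bag⇒↭)
open import Data.List.Relation.Binary.Disjoint.Propositional using (Disjoint)
open import Data.List.Relation.Binary.Permutation.Propositional
  using (_↭_; ↭-refl; ↭-sym; ↭-trans; ↭-prep; ↭-swap; ↭-reflexive; ↭⇒↭ₛ;
         module PermutationReasoning)
open import Data.List.Relation.Binary.Permutation.Propositional.Properties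
  using (All-resp-↭; Any-resp-↭; ∈-resp-↭; ↭-length; drop-∷; ↭-empty-inv; ++-comm; ++⁺ˡ; shifts)
import Data.List.Relation.Binary.Permutation.Setoid.Properties as Permutationₛ
open import Data.List.Relation.Unary.All as All using (All; []; _∷_)
import Data.List.Relation.Unary.All.Properties as All
open import Data.List.Relation.Unary.AllPairs as AllPairs using (AllPairs; []; _∷_)
import Data.List.Relation.Unary.AllPairs.Properties as AllPairs
open import Data.List.Relation.Unary.Any as Any using (here; there)
import Data.List.Relation.Unary.Any.Properties as Any
open import Data.List.Relation.Unary.Linked as Linked using (Linked; []; [-]; _∷_)
import Data.List.Relation.Unary.Linked.Properties as Linked
open import Data.List.Relation.Unary.Unique.Propositional using (Unique)
import Data.List.Relation.Unary.Unique.Propositional.Properties as Unique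
open import Data.Nat.Base
  using (ℕ; zero; suc; _+_; _*_; _^_; _/_; _!; _⊓_; _≤_; _≥_; z≤n; s≤s)
open import Data.Nat.DivMod using (m*n/n≡m; /-congˡ)
open import Data.Nat.Properties
  using (≤-antisym; ≤-reflexive; ≤-trans; +-suc; suc-injective; ⊓-glb)
open import Data.Nat.Solver using (module +-*-Solver)
open import Data.Product.Base using (_×_; _,_; proj₁; proj₂; ∃; map₂; uncurry)
import Data.Product.Properties as Product
open import Data.Sum.Base as Sum using (_⊎_; inj₁; inj₂)
open import Data.Unit.Base using (tt)
import Data.Vec.Base as Vec
import Data.Vec.Properties as Vec
open import Function.Base using (_∘_; id)
open import Function.Bundles using (mk⇔; module Inverse)
open import Function.Definitions using (Injective)
open import Relation.Binary.Definitions
  using (Decidable; Reflexive; Symmetric; Transitive; tri<; tri≈; tri>)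
open import Relation.Binary.PropositionalEquality
  using (_≡_; _≢_; refl; sym; trans; cong; cong₂; subst; setoid; module ≡-Reasoning)
open import Relation.Nullary.Decidable using (Dec; yes; no; does; dec-true; map′)
open import Relation.Nullary.Negation using (¬_; contradiction)

-- A cycle with k turns can be cut before any of its k visits to `T₁`. The fixed vertex singles out
-- one of these cuts, so instead of an orbit count with a division by k there remains a count of
-- plain lists, and the quotient `(k !) ^ 3 / k` is exact. Both inequalities come from one relation,
-- `HasShape`, between cycles and triples of ordered partitions, read as an injection in either
-- direction. A cycle determines its triple in all tournaments, because its arcs recover the rooted
-- listing; as every triple is realised, this gives the lower bound. A triple determines its cycle
-- once every part carries a single Hamilton path, and this is where transitivity enters. The
-- obstacle is that cycles and partitions are both counted as lists up to equality of their sets of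
-- entries. The kept representative of a cycle may be any of its rotations, so distinctness is
-- available only in the form of a negated `SameSet`.

private
  variable
    A B C : Set
    k m n m₁ m₂ m₃ : ℕ

-- Counting by injections and by classes

-- Match the head with some y and delete that occurrence of y: separation keeps the images of the
-- other entries away from it. A general `_#_` in place of `_≢_` admits lists whose entries are
-- distinct only up to `SameSet`.
pigeonhole : {R : A → B → Set} {_#_ : A → A → Set} {xs : List A} {ys : List B} →
  AllPairs _#_ xs →
  (∀ {x} → x ∈ xs → ∃ λ y → y ∈ ys × R x y) →
  (∀ {x x′ y} → x ∈ xs → x′ ∈ xs → R x y → R x′ y → ¬ x # x′) →
  length xs ≤ length ys
pigeonhole [] _ _ = z≤n
pigeonhole {R = R} {_#_} {x ∷ xs} (x#xs ∷ xs#) image separate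
  with y , y∈ys , Rxy ← image (here refl)
  with ys₁ , ys₂ , refl ← ∈-∃++ y∈ys =
  ≤-trans (s≤s (pigeonhole {R = R} {_#_} xs# image′ λ u v → separate (there u) (there v)))
          (≤-reflexive (sym (trans (length-++ ys₁)
            (trans (+-suc (length ys₁) (length ys₂)) (cong suc (sym (length-++ ys₁)))))))
  where
  image′ : ∀ {x} → x ∈ xs → ∃ λ y → y ∈ ys₁ ++ ys₂ × R x y
  image′ x′∈xs with y′ , y′∈ys , Rx′y′ ← image (there x′∈xs) with ∈-++⁻ ys₁ y′∈ys
  ... | inj₁ p            = y′ , ∈-++⁺ˡ p , Rx′y′
  ... | inj₂ (there p)    = y′ , ∈-++⁺ʳ ys₁ p , Rx′y′
  ... | inj₂ (here refl)  =
    ⊥-elim (separate (here refl) (there x′∈xs) Rxy Rx′y′ (All.lookup x#xs x′∈xs))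

unique-⊆⇒length≤ : {xs ys : List A} → Unique xs → (∀ {x} → x ∈ xs → x ∈ ys) →
  length xs ≤ length ys
unique-⊆⇒length≤ xs! xs⊆ys =
  pigeonhole {R = _≡_} xs! (λ x∈xs → _ , xs⊆ys x∈xs , refl) λ _ _ p q x≢x′ → x≢x′ (trans p (sym q))

unique-sameSet⇒↭ : {xs ys : List A} → Unique xs → Unique ys →
  (∀ {x} → x ∈ xs → x ∈ ys) → (∀ {x} → x ∈ ys → x ∈ xs) → xs ↭ ys
unique-sameSet⇒↭ xs! ys! f g = ∼bag⇒↭ (unique∧set⇒bag xs! ys! (mk⇔ f g))

Unique-resp-↭ : {xs ys : List A} → xs ↭ ys → Unique xs → Unique ys
Unique-resp-↭ xs↭ys = Permutationₛ.Unique-resp-↭ (setoid _) (↭⇒↭ₛ xs↭ys)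

AllPairs-resp-↭ : {R : A → A → Set} → Symmetric R → {xs ys : List A} →
  xs ↭ ys → AllPairs R xs → AllPairs R ys
AllPairs-resp-↭ {R = R} R-sym xs↭ys =
  Permutationₛ.AllPairs-resp-↭ (setoid _) R-sym
    ((λ { refl → id }) , (λ { refl → id })) (↭⇒↭ₛ xs↭ys)

concatMap-unique : (f : A → List B) {_#_ : A → A → Set} {xs : List A} → AllPairs _#_ xs →
  (∀ {x} → x ∈ xs → Unique (f x)) →
  (∀ {x x′ y} → x ∈ xs → x′ ∈ xs → y ∈ f x → y ∈ f x′ → ¬ x # x′) →
  Unique (concatMap f xs)
concatMap-unique f [] _ _ = []
concatMap-unique f {_#_} {x ∷ xs} (x#xs ∷ xs#) unique separate =
  Unique.++⁺ (unique (here refl))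
    (concatMap-unique f {_#_} xs# (unique ∘ there) λ p q → separate (there p) (there q))
    λ (y∈fx , y∈rest) →
      let x′ , x′∈xs , y∈fx′ = find (∈-concatMap⁻ f y∈rest)
      in separate (here refl) (there x′∈xs) y∈fx y∈fx′ (All.lookup x#xs x′∈xs)

length-concatMap : (f : A → List B) {xs : List A} → (∀ {x} → x ∈ xs → length (f x) ≡ k) →
  length (concatMap f xs) ≡ length xs * k
length-concatMap f {[]} _ = refl
length-concatMap f {x ∷ xs} size =
  trans (length-++ (f x)) (cong₂ _+_ (size (here refl)) (length-concatMap f (size ∘ there)))

-- The classes `f x` are disjoint, of equal size, and exhaust `ys`, so their concatenation has the
-- length of `ys`. In the applications `reps` holds unordered partitions and `f x` the admissible
-- orderings of x.
classes-count : (f : A → List B) {_#_ : A → A → Set} {reps : List A} {ys : List B} →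
  AllPairs _#_ reps → Unique ys →
  (∀ {x} → x ∈ reps → Unique (f x)) →
  (∀ {x} → x ∈ reps → length (f x) ≡ k) →
  (∀ {x x′ y} → x ∈ reps → x′ ∈ reps → y ∈ f x → y ∈ f x′ → ¬ x # x′) →
  (∀ {x y} → x ∈ reps → y ∈ f x → y ∈ ys) →
  (∀ {y} → y ∈ ys → ∃ λ x → x ∈ reps × y ∈ f x) →
  length ys ≡ length reps * k
classes-count f {_#_} reps# ys! unique size separate sound complete =
  trans (≤-antisym
    (unique-⊆⇒length≤ ys! λ y∈ys →
      let x , x∈reps , y∈fx = complete y∈ys in ∈-concatMap⁺ f (lose x∈reps y∈fx))
    (unique-⊆⇒length≤ (concatMap-unique f {_#_} reps# unique separate) λ y∈ →
      let x , x∈reps , y∈fx = find (∈-concatMap⁻ f y∈) in sound x∈reps y∈fx))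
  (length-concatMap f size)

module _ {_~_ : A → A → Set} (_~?_ : Decidable _~_) where

  deduplicate-separated : ∀ xs → AllPairs (λ x y → ¬ x ~ y) (deduplicate _~?_ xs)
  deduplicate-separated []       = []
  deduplicate-separated (x ∷ xs) =
    All.all-filter _ (deduplicate _~?_ xs) ∷ AllPairs.filter⁺ _ (deduplicate-separated xs)

  deduplicate-complete : Reflexive _~_ → Transitive _~_ → ∀ {x} {xs : List A} → x ∈ xs →
    ∃ λ y → y ∈ deduplicate _~?_ xs × y ~ x
  deduplicate-complete ~-refl ~-trans x∈xs =
    find (Any.deduplicate⁺ _~?_ ~-trans (Any.map (λ { refl → ~-refl }) x∈xs))

-- Permutations of a list

choices : List A → List (A × List A)
choices []       = []
choices (x ∷ xs) = (x , xs) ∷ map (map₂ (x ∷_)) (choices xs)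

map-proj₁-choices : (xs : List A) → map proj₁ (choices xs) ≡ xs
map-proj₁-choices []       = refl
map-proj₁-choices (x ∷ xs) =
  cong (x ∷_) (trans (sym (map-∘ (choices xs))) (map-proj₁-choices xs))

choices-↭ : {xs ys : List A} {y : A} → (y , ys) ∈ choices xs → y ∷ ys ↭ xs
choices-↭ {xs = x ∷ xs} (here refl) = ↭-refl
choices-↭ {xs = x ∷ xs} (there p) with _ , q , refl ← ∈-map⁻ (map₂ (x ∷_)) p =
  ↭-trans (↭-swap _ _ ↭-refl) (↭-prep x (choices-↭ q))

choices-complete : {xs : List A} {y : A} → y ∈ xs → ∃ λ ys → (y , ys) ∈ choices xs
choices-complete {xs = xs} y∈xs
  with (_ , ys) , p , refl ← ∈-map⁻ proj₁ (subst (_ ∈_) (sym (map-proj₁-choices xs)) y∈xs) = ys , p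

length-choices : (xs : List A) → length (choices xs) ≡ length xs
length-choices xs =
  trans (sym (length-map proj₁ (choices xs))) (cong length (map-proj₁-choices xs))

-- The number drives the recursion, since a remainder found by `choices` is no structural part of
-- the list; the lemmas take it to be the length of the list.
perms : ℕ → List A → List (List A)
perms zero    _  = [] ∷ []
perms (suc n) xs = concatMap (λ (y , ys) → map (y ∷_) (perms n ys)) (choices xs)

private
  rest-length : {xs ys : List A} {y : A} → (y , ys) ∈ choices xs → length xs ≡ suc n → length ys ≡ n
  rest-length p |xs| = suc-injective (trans (↭-length (choices-↭ p)) |xs|)

perms-↭ : ∀ n {xs : List A} → length xs ≡ n → ∀ {w} → w ∈ perms n xs → w ↭ xs
perms-↭ zero {[]} refl (here refl) = ↭-refl
perms-↭ (suc n) {xs} |xs| w∈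
  with (y , ys) , c , q ← find (∈-concatMap⁻ _ {choices xs} w∈)
  with w , w∈ , refl ← ∈-map⁻ (y ∷_) q =
  ↭-trans (↭-prep y (perms-↭ n (rest-length c |xs|) w∈)) (choices-↭ c)

perms-complete : ∀ n {xs : List A} → length xs ≡ n → ∀ {w} → w ↭ xs → w ∈ perms n xs
perms-complete zero {[]} refl w↭ with refl ← ↭-empty-inv w↭ = here refl
perms-complete (suc n) |xs| {[]} w↭ with () ← trans (↭-length w↭) |xs|
perms-complete (suc n) {xs} |xs| {y ∷ w} w↭
  with ys , c ← choices-complete (∈-resp-↭ w↭ (here refl)) =
  ∈-concatMap⁺ _ {choices xs} (lose c (∈-map⁺ (y ∷_)
    (perms-complete n (rest-length c |xs|) (drop-∷ (↭-trans w↭ (↭-sym (choices-↭ c)))))))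

length-perms : ∀ n {xs : List A} → length xs ≡ n → length (perms n xs) ≡ n !
length-perms zero    _    = refl
length-perms (suc n) {xs} |xs| =
  trans (length-concatMap _ {choices xs} λ c →
          trans (length-map _ (perms n _)) (length-perms n (rest-length c |xs|)))
        (cong (_* n !) (trans (length-choices xs) |xs|))

perms-unique : ∀ n {xs : List A} → length xs ≡ n → Unique xs → Unique (perms n xs)
perms-unique zero    _    _   = [] ∷ []
perms-unique (suc n) {xs} |xs| xs! =
  concatMap-unique _
    (AllPairs.map⁻ (subst Unique (sym (map-proj₁-choices xs)) xs!))
    (λ c → Unique.map⁺ (proj₂ ∘ ∷-injective)
      (perms-unique n (rest-length c |xs|)
        (AllPairs.tail (Unique-resp-↭ (↭-sym (choices-↭ c)) xs!))))
    λ { {y , ys} {y′ , ys′} _ _ p q y≢y′ →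
        let _ , _ , e = ∈-map⁻ (y ∷_) p
            _ , _ , e′ = ∈-map⁻ (y′ ∷_) q
        in y≢y′ (proj₁ (∷-injective (trans (sym e) e′))) }

words-complete : {xs w : List A} → All (_∈ xs) w → w ∈ words (length w) xs
words-complete []         = here refl
words-complete (x∈ ∷ w∈) = ∈-cartesianProductWith⁺ _∷_ x∈ (words-complete w∈)

words-length : ∀ n {xs w : List A} → w ∈ words n xs → length w ≡ n
words-length zero    (here refl) = refl
words-length (suc n) {xs} w∈
  with _ , _ , _ , w∈ , refl ← ∈-cartesianProductWith⁻ _∷_ xs (words n xs) w∈ =
  cong suc (words-length n w∈)

words-unique : ∀ n {xs : List A} → Unique xs → Unique (words n xs)
words-unique zero    _   = [] ∷ []
words-unique (suc n) xs! = Unique.cartesianProductWith⁺ _∷_ ∷-injective xs! (words-unique n xs!)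

-- Ordered set partitions

subsets-complete : (p : Subset m) → p ∈ subsets m
subsets-complete Vec.[]           = here refl
subsets-complete (true  Vec.∷ p) =
  ∈-cartesianProductWith⁺ Vec._∷_ {xs = true ∷ false ∷ []} (here refl) (subsets-complete p)
subsets-complete (false Vec.∷ p) =
  ∈-cartesianProductWith⁺ Vec._∷_ {xs = true ∷ false ∷ []} (there (here refl)) (subsets-complete p)

subsets-unique : ∀ m → Unique (subsets m)
subsets-unique zero    = [] ∷ []
subsets-unique (suc m) =
  Unique.cartesianProductWith⁺ Vec._∷_ Vec.∷-injective
    (((λ ()) ∷ []) ∷ [] ∷ []) (subsets-unique m)

sameSet-refl : {xs : List A} → SameSet xs xs
sameSet-refl = id , id

sameSet-sym : {xs ys : List A} → SameSet xs ys → SameSet ys xs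
sameSet-sym (f , g) = g , f

sameSet-trans : {xs ys zs : List A} → SameSet xs ys → SameSet ys zs → SameSet xs zs
sameSet-trans (f , g) (f′ , g′) = f′ ∘ f , g ∘ g′

module _ {m : ℕ} where

  isPartition-resp-↭ : {Ps Qs : List (Subset m)} → Ps ↭ Qs → IsPartition Ps → IsPartition Qs
  isPartition-resp-↭ Ps↭Qs (nonempty , disjoint , cover) =
    All-resp-↭ Ps↭Qs nonempty ,
    AllPairs-resp-↭
      (λ {P} {Q} ∩∅ (i , i∈) → ∩∅ (i , x∈p∩q⁺ (let q , p = x∈p∩q⁻ Q P i∈ in p , q)))
      Ps↭Qs disjoint ,
    Any-resp-↭ Ps↭Qs ∘ cover

  isPartition⇒unique : {Ps : List (Subset m)} → IsPartition Ps → Unique Ps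
  isPartition⇒unique (nonempty , disjoint , _) = go nonempty disjoint
    where
    go : ∀ {Ps : List (Subset m)} →
      All Nonempty Ps → AllPairs (λ p q → Empty (p ∩ q)) Ps → Unique Ps
    go []                 []        = []
    go ((i , i∈) ∷ ne) (d ∷ ds) =
      All.map (λ { ∩∅ refl → ∩∅ (i , x∈p∩q⁺ (i∈ , i∈)) }) d ∷ go ne ds

  part-unique : {Ps : List (Subset m)} → IsPartition Ps → ∀ {P Q i} →
    P ∈ Ps → Q ∈ Ps → i ∈ˢ P → i ∈ˢ Q → P ≡ Q
  part-unique (_ , disjoint , _) P∈ Q∈ i∈P i∈Q with ∈-AllPairs₂ disjoint P∈ Q∈
  ... | inj₁ P≡Q          = P≡Q
  ... | inj₂ (inj₁ ∩∅) = contradiction (_ , x∈p∩q⁺ (i∈P , i∈Q)) ∩∅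
  ... | inj₂ (inj₂ ∩∅) = contradiction (_ , x∈p∩q⁺ (i∈Q , i∈P)) ∩∅

  partitions : ℕ → List (List (Subset m))
  partitions k = filter isPartition? (words k (subsets m))

  ∈-partitions⁺ : ∀ {Ps} → IsPartition Ps → Ps ∈ partitions (length Ps)
  ∈-partitions⁺ isP =
    ∈-filter⁺ isPartition? (words-complete (All.tabulate λ _ → subsets-complete _)) isP

  ∈-partitions⁻ : ∀ {Ps} → Ps ∈ partitions k → length Ps ≡ k × IsPartition Ps
  ∈-partitions⁻ {k} Ps∈ =
    let w∈ , isP = ∈-filter⁻ isPartition? {xs = words k (subsets m)} Ps∈ in words-length k w∈ , isP

  partitions-unique : ∀ k → Unique (partitions k)
  partitions-unique k = Unique.filter⁺ isPartition? (words-unique k (subsets-unique m))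

  -- S m k is, by definition, the length of this list.
  representatives : ℕ → List (List (Subset m))
  representatives k = deduplicate (sameSet? (Vec.≡-dec Bool._≟_)) (partitions k)

  private
    ∈-representatives⁻ : ∀ {Ps} → Ps ∈ representatives k → Ps ∈ partitions k
    ∈-representatives⁻ {k} = ∈-deduplicate⁻ (sameSet? _) (partitions k)

    -- A common ordering makes the two lists permutations of each other. The double negation is the
    -- form that `classes-count` takes when `_#_` is the negated `SameSet`.
    rep-perms-separate : ∀ {Ps Qs w} → Ps ∈ representatives k → Qs ∈ representatives k →
      w ∈ perms k Ps → w ∈ perms k Qs → ¬ ¬ SameSet Ps Qs
    rep-perms-separate {k} Ps∈ Qs∈ w∈ w∈′ Ps≁Qs =
      Ps≁Qs (∈-resp-↭ Ps↭Qs , ∈-resp-↭ (↭-sym Ps↭Qs))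
      where
      size : ∀ {Ps} → Ps ∈ representatives k → length Ps ≡ k
      size Ps∈ = proj₁ (∈-partitions⁻ (∈-representatives⁻ {k} Ps∈))
      Ps↭Qs = ↭-trans (↭-sym (perms-↭ k (size Ps∈) w∈)) (perms-↭ k (size Qs∈) w∈′)

    rep-perms-sound : ∀ {Ps w} → Ps ∈ representatives k → w ∈ perms k Ps → w ∈ partitions k
    rep-perms-sound {k} {Ps} {w} Ps∈ w∈ =
      let |Ps| , isP = ∈-partitions⁻ (∈-representatives⁻ {k} Ps∈)
          w↭Ps       = perms-↭ k |Ps| w∈
      in subst (λ k → w ∈ partitions k) (trans (↭-length w↭Ps) |Ps|)
           (∈-partitions⁺ (isPartition-resp-↭ (↭-sym w↭Ps) isP))

    -- Nonempty disjoint parts occur only once in a list, so two partitions with the same set of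
    -- parts are permutations of each other.
    rep-perms-complete : ∀ {w} → w ∈ partitions k →
      ∃ λ Ps → Ps ∈ representatives k × w ∈ perms k Ps
    rep-perms-complete {k} {w} w∈ =
      let Ps , Ps∈ , f , g = deduplicate-complete (sameSet? _) sameSet-refl sameSet-trans w∈
          |Ps| , isP  = ∈-partitions⁻ (∈-representatives⁻ {k} Ps∈)
          _    , isP′ = ∈-partitions⁻ {k} w∈
      in Ps , Ps∈ , perms-complete k |Ps|
           (unique-sameSet⇒↭ (isPartition⇒unique isP′) (isPartition⇒unique isP) g f)

    rep-perms-unique : ∀ {Ps} → Ps ∈ representatives k → Unique (perms k Ps)
    rep-perms-unique {k} Ps∈ =
      let |Ps| , isP = ∈-partitions⁻ (∈-representatives⁻ {k} Ps∈)
      in perms-unique k |Ps| (isPartition⇒unique isP)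

  length-partitions : ∀ k → length (partitions k) ≡ S m k * k !
  length-partitions k =
    classes-count (perms k)
      (deduplicate-separated (sameSet? _) (partitions k))
      (partitions-unique k)
      (rep-perms-unique {k})
      (λ Ps∈ → length-perms k (proj₁ (∈-partitions⁻ (∈-representatives⁻ {k} Ps∈))))
      (rep-perms-separate {k})
      (rep-perms-sound {k})
      (rep-perms-complete {k})

  data InFirst (i : Fin m) : List (Subset m) → Set where
    first : ∀ {P Ps} → i ∈ˢ P → InFirst i (P ∷ Ps)

  inFirst? : ∀ i Ps → Dec (InFirst i Ps)
  inFirst? i []       = no λ ()
  inFirst? i (P ∷ Ps) = map′ first (λ { (first i∈P) → i∈P }) (i ∈ˢ? P)

  rootedPartitions : Fin m → ℕ → List (List (Subset m))
  rootedPartitions i k = filter (inFirst? i) (partitions k)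

  -- Exactly one part P contains i. It has to come first, and the other k parts are permuted freely.
  length-rooted-perms : ∀ i k {Ps} → length Ps ≡ suc k → IsPartition Ps →
    length (filter (inFirst? i) (perms (suc k) Ps)) ≡ k !
  length-rooted-perms i k {Ps} |Ps| isP
    with P , P∈ , i∈P ← find (proj₂ (proj₂ isP) i)
    with Qs , c ← choices-complete P∈ =
    trans (≤-antisym
      (pigeonhole {R = λ w v → w ≡ P ∷ v} (Unique.filter⁺ (inFirst? i) ws!) toTail
        λ { _ _ refl refl w≢w → w≢w refl })
      (pigeonhole {R = λ v w → w ≡ P ∷ v} (perms-unique k |Qs| Qs!) fromTail
        λ { _ _ refl refl v≢v → v≢v refl }))
    (length-perms k |Qs|)
    where
    P∷Qs↭Ps = choices-↭ c
    Ps!     = isPartition⇒unique isP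
    ws!     = perms-unique (suc k) |Ps| Ps!
    |Qs|    = suc-injective (trans (↭-length P∷Qs↭Ps) |Ps|)
    Qs!     = AllPairs.tail (Unique-resp-↭ (↭-sym P∷Qs↭Ps) Ps!)

    toTail : ∀ {w} → w ∈ filter (inFirst? i) (perms (suc k) Ps) →
      ∃ λ v → v ∈ perms k Qs × w ≡ P ∷ v
    toTail w∈ with ∈-filter⁻ (inFirst? i) {xs = perms (suc k) Ps} w∈
    ... | w∈ , first {Q} {v} i∈Q with w↭Ps ← perms-↭ (suc k) |Ps| w∈
      with refl ← part-unique isP P∈ (∈-resp-↭ w↭Ps (here refl)) i∈P i∈Q =
      v , perms-complete k |Qs| (drop-∷ (↭-trans w↭Ps (↭-sym P∷Qs↭Ps))) , refl

    fromTail : ∀ {v} → v ∈ perms k Qs →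
      ∃ λ w → w ∈ filter (inFirst? i) (perms (suc k) Ps) × w ≡ P ∷ v
    fromTail {v} v∈ = P ∷ v , ∈-filter⁺ (inFirst? i)
      (perms-complete (suc k) |Ps| (↭-trans (↭-prep P (perms-↭ k |Qs| v∈)) P∷Qs↭Ps))
      (first i∈P) , refl

  length-rootedPartitions : ∀ i k → length (rootedPartitions i (suc k)) ≡ S m (suc k) * k !
  length-rootedPartitions i k =
    classes-count (filter (inFirst? i) ∘ perms (suc k))
      (deduplicate-separated (sameSet? _) (partitions (suc k)))
      (Unique.filter⁺ (inFirst? i) (partitions-unique (suc k)))
      (λ Ps∈ → Unique.filter⁺ (inFirst? i) (rep-perms-unique {suc k} Ps∈))
      (λ Ps∈ → let |Ps| , isP = ∈-partitions⁻ (∈-representatives⁻ {suc k} Ps∈)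
                in length-rooted-perms i k |Ps| isP)
      (λ {Ps} {Qs} Ps∈ Qs∈ p q → rep-perms-separate {suc k} Ps∈ Qs∈
        (proj₁ (∈-filter⁻ (inFirst? i) {xs = perms (suc k) Ps} p))
        (proj₁ (∈-filter⁻ (inFirst? i) {xs = perms (suc k) Qs} q)))
      (λ {Ps} Ps∈ p → let w∈ , h = ∈-filter⁻ (inFirst? i) {xs = perms (suc k) Ps} p
                      in ∈-filter⁺ (inFirst? i) (rep-perms-sound {suc k} Ps∈ w∈) h)
      (λ w∈ → let w∈ , h = ∈-filter⁻ (inFirst? i) {xs = partitions (suc k)} w∈
                  Ps , Ps∈ , p = rep-perms-complete {suc k} w∈
              in Ps , Ps∈ , ∈-filter⁺ (inFirst? i) p h)

  -- An element chosen from each part identifies the part, by disjointness. This bounds the number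
  -- of turns of a cycle, and so explains the range of the sum.
  partition-size : {Ps : List (Subset m)} → IsPartition Ps → length Ps ≤ m
  partition-size {Ps} isP@(nonempty , _) =
    subst (length Ps ≤_) (length-tabulate {n = m} id)
      (pigeonhole {R = λ P i → i ∈ˢ P} {ys = allFin m} (isPartition⇒unique isP)
        (λ P∈ → let i , i∈P = All.lookup nonempty P∈ in i , ∈-allFin i , i∈P)
        λ P∈ Q∈ i∈P i∈Q P≢Q → P≢Q (part-unique isP P∈ Q∈ i∈P i∈Q))

-- Closed walks

module _ {A : Set} where

  -- The arcs of an open walk from u through z to c. A closed walk `arcs (v ∷ z)` is definitionally
  -- `steps v z v`, and separating the two ends lets an induction advance the start while the target
  -- stays fixed.
  steps : A → List A → A → List (A × A)
  steps u z c = zip (u ∷ z) (z ∷ʳ c)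

  map-proj₁-steps : ∀ u z c → map proj₁ (steps u z c) ≡ u ∷ z
  map-proj₁-steps u []      c = refl
  map-proj₁-steps u (a ∷ z) c = cong (u ∷_) (map-proj₁-steps a z c)

  steps-++ : ∀ u z a z′ c → steps u (z ++ a ∷ z′) c ≡ steps u z a ++ steps a z′ c
  steps-++ u []      a z′ c = refl
  steps-++ u (b ∷ z) a z′ c = cong (_ ∷_) (steps-++ b z a z′ c)

  -- Both closed walks consist of the open walk from x to y and the one from y to x, taken in
  -- opposite orders.
  arcs-rotate : ∀ xs ys → arcs (xs ++ ys) ↭ arcs (ys ++ xs)
  arcs-rotate []       ys       = ↭-reflexive (cong arcs (sym (++-identityʳ ys)))
  arcs-rotate (x ∷ xs) []       = ↭-reflexive (cong arcs (++-identityʳ (x ∷ xs)))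
  arcs-rotate (x ∷ xs) (y ∷ ys) =
    ↭-trans (↭-reflexive (steps-++ x xs y ys x))
    (↭-trans (++-comm (steps x xs y) (steps y ys x))
      (↭-reflexive (sym (steps-++ y ys x xs y))))

  module _ {R : A → A → Set} where

    steps⇒linked : ∀ u z c → All (uncurry R) (steps u z c) → Linked R (u ∷ z ∷ʳ c)
    steps⇒linked u []      c (e ∷ []) = e ∷ [-]
    steps⇒linked u (a ∷ z) c (e ∷ es) = e ∷ steps⇒linked a z c es

    linked⇒steps : ∀ u z c → Linked R (u ∷ z ∷ʳ c) → All (uncurry R) (steps u z c)
    linked⇒steps u []      c (e ∷ [-]) = e ∷ []
    linked⇒steps u (a ∷ z) c (e ∷ es)  = e ∷ linked⇒steps a z c es

    -- The junction condition speaks of every entry of `xs`, not just the last: in `C₃` an edge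
    -- between two parts depends on the parts alone, so the last entry need not be identified.
    linked-++⁺ : ∀ {xs ys} → Linked R xs → Linked R ys →
      (∀ {x y t} → x ∈ xs → ys ≡ y ∷ t → R x y) → Linked R (xs ++ ys)
    linked-++⁺ []                      L _ = L
    linked-++⁺ {ys = []}    [-]       _ _ = [-]
    linked-++⁺ {ys = _ ∷ _} [-]       L c = c (here refl) refl ∷ L
    linked-++⁺ (e ∷ es)                L c = e ∷ linked-++⁺ es L (c ∘ there)

    linked-++⁻ˡ : ∀ xs {ys} → Linked R (xs ++ ys) → Linked R xs
    linked-++⁻ˡ []           _        = []
    linked-++⁻ˡ (x ∷ [])     _        = [-]
    linked-++⁻ˡ (x ∷ y ∷ xs) (e ∷ es) = e ∷ linked-++⁻ˡ (y ∷ xs) es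

    linked-++⁻ʳ : ∀ xs {ys} → Linked R (xs ++ ys) → Linked R ys
    linked-++⁻ʳ []       L = L
    linked-++⁻ʳ (x ∷ xs) L = linked-++⁻ʳ xs (Linked.tail L)

  functional : {F : List (A × A)} → Unique (map proj₁ F) →
    ∀ {u a b} → (u , a) ∈ F → (u , b) ∈ F → a ≡ b
  functional F! p q with ∈-AllPairs₂ (AllPairs.map⁻ F!) p q
  ... | inj₁ refl           = refl
  ... | inj₂ (inj₁ u≢u) = contradiction refl u≢u
  ... | inj₂ (inj₂ u≢u) = contradiction refl u≢u

  -- Every vertex has at most one successor in F, so both walks are forced step by step. They also
  -- stop together: if one reached c earlier, the other would have c in its interior.
  steps-determined : ∀ {F c} → Unique (map proj₁ F) → ∀ {u} z z′ → c ∉ z → c ∉ z′ →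
    (∀ {e} → e ∈ steps u z c → e ∈ F) → (∀ {e} → e ∈ steps u z′ c → e ∈ F) → z ≡ z′
  steps-determined F! []      []       _   _    _ _ = refl
  steps-determined F! []      (b ∷ z′) _   c∉z′ f g =
    contradiction (here (functional F! (f (here refl)) (g (here refl)))) c∉z′
  steps-determined F! (a ∷ z) []       c∉z _    f g =
    contradiction (here (functional F! (g (here refl)) (f (here refl)))) c∉z
  steps-determined F! (a ∷ z) (b ∷ z′) c∉z c∉z′ f g
    with refl ← functional F! (f (here refl)) (g (here refl)) =
    cong (a ∷_) (steps-determined F! z z′ (c∉z ∘ there) (c∉z′ ∘ there) (f ∘ there) (g ∘ there))

  arcs-determined : ∀ {v z z′} → Unique (v ∷ z) → Unique (v ∷ z′) →
    SameSet (arcs (v ∷ z)) (arcs (v ∷ z′)) → z ≡ z′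
  arcs-determined {v} {z} {z′} z! z′! (f , _) =
    steps-determined (subst Unique (sym (map-proj₁-steps v z′ v)) z′!) z z′
      (Unique.Unique[x∷xs]⇒x∉xs z!) (Unique.Unique[x∷xs]⇒x∉xs z′!) f id

  unique-++⁻ : ∀ xs {ys : List A} → Unique (xs ++ ys) → Unique xs × Unique ys × Disjoint xs ys
  unique-++⁻ []       ys!         = [] , ys! , λ ()
  unique-++⁻ (x ∷ xs) (x∉ ∷ xs!) =
    let xs! , ys! , disjoint = unique-++⁻ xs xs!
    in All.++⁻ˡ xs x∉ ∷ xs! , ys! , λ where
         (here refl , p) → All.lookup (All.++⁻ʳ xs x∉) p refl
         (there q   , p) → disjoint (q , p)

  unique-concat⁻ : ∀ xss → Unique (concat xss) → AllPairs Disjoint xss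
  unique-concat⁻ []         _ = []
  unique-concat⁻ (xs ∷ xss) u =
    let _ , u′ , disjoint = unique-++⁻ xs u
    in All.tabulate (λ ys∈ (p , q) → disjoint (p , ∈-concat⁺′ q ys∈)) ∷ unique-concat⁻ xss u′

-- Path covers of a tournament

module _ (T : Tournament m) where
  open Tournament T
  open Inverse finite using (to; from; strictlyInverseˡ; strictlyInverseʳ)
  open DecMembership _≟_ using (_∈?_)

  ∈-vertices : ∀ v → v ∈ vertices
  ∈-vertices v = subst (_∈ vertices) (strictlyInverseˡ v) (∈-map⁺ to (∈-allFin (from v)))

  to-injective : ∀ {i j} → to i ≡ to j → i ≡ j
  to-injective {i} {j} e =
    trans (sym (strictlyInverseʳ i)) (trans (cong from e) (strictlyInverseʳ j))

  vertices-unique : Unique vertices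
  vertices-unique = Unique.map⁺ to-injective (Unique.allFin⁺ m)

  listing-length : ∀ {vs} → Unique vs → (∀ v → v ∈ vs) → length vs ≡ m
  listing-length vs! spanning =
    trans (≤-antisym (unique-⊆⇒length≤ vs! λ _ → ∈-vertices _)
                     (unique-⊆⇒length≤ vertices-unique λ _ → spanning _))
          (trans (length-map to (allFin m)) (length-tabulate id))

  ∈-hamiltonListings : ∀ {vs} → IsHamiltonCycle T vs → vs ∈ hamiltonListings T
  ∈-hamiltonListings {vs} ham@(isHamiltonCycle (isDirectedCycle _ vs! _) spanning) =
    ∈-filter⁺ (isHamiltonCycle? T)
      (subst (λ n → vs ∈ words n vertices) (listing-length vs! spanning)
        (words-complete (All.tabulate λ _ → ∈-vertices _)))
      ham

  hamilton-rotate : ∀ xs ys → IsHamiltonCycle T (xs ++ ys) → IsHamiltonCycle T (ys ++ xs)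
  hamilton-rotate xs ys (isHamiltonCycle (isDirectedCycle ne u es) spanning) =
    isHamiltonCycle
      (isDirectedCycle (λ e → ne (↭-empty-inv (↭-trans (++-comm xs ys) (↭-reflexive e))))
        (Unique-resp-↭ (++-comm xs ys) u) (All-resp-↭ (arcs-rotate xs ys) es))
      (∈-resp-↭ (++-comm xs ys) ∘ spanning)

  -- Set partitions are counted on the indices `Fin m`, whereas vertices form an arbitrary type;
  -- this carries the vertex set of a path over to the indices.
  support : List Vertex → Subset m
  support p = Vec.tabulate λ i → does (to i ∈? p)

  ∈-support⁺ : ∀ {i p} → to i ∈ p → i ∈ˢ support p
  ∈-support⁺ {i} {p} v∈p =
    Vec.lookup⇒[]= i _ (trans (Vec.lookup∘tabulate _ i) (dec-true (to i ∈? p) v∈p))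

  ∈-support⁻ : ∀ {i p} → i ∈ˢ support p → to i ∈ p
  ∈-support⁻ {i} {p} i∈ with to i ∈? p | trans (sym (Vec.lookup∘tabulate _ i)) (Vec.[]=⇒lookup i∈)
  ... | yes v∈p | _ = v∈p

  ∈-support-from : ∀ {v p} → v ∈ p → from v ∈ˢ support p
  ∈-support-from {v} {p} v∈p = ∈-support⁺ {p = p} (subst (_∈ p) (sym (strictlyInverseˡ v)) v∈p)

  record PathCover (ps : List (List Vertex)) : Set where
    constructor pathCover
    field
      nonempty : All (_≢ []) ps
      linked   : All (Linked _⟶_) ps
      distinct : Unique (concat ps)
      spanning : ∀ v → v ∈ concat ps

  pathCover⇒partition : ∀ {ps} → PathCover ps → IsPartition (map support ps)
  pathCover⇒partition {ps} (pathCover nonempty _ distinct spanning) =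
    All.map⁺ (All.map inhabited nonempty) ,
    AllPairs.map⁺ (AllPairs.map disjoint (unique-concat⁻ ps distinct)) ,
    λ i → Any.map⁺ (Any.map ∈-support⁺ (∈-concat⁻ ps (spanning (to i))))
    where
    inhabited : ∀ {p} → p ≢ [] → Nonempty (support p)
    inhabited {[]}    p≢[] = contradiction refl p≢[]
    inhabited {v ∷ p} _    = from v , ∈-support-from {p = v ∷ p} (here refl)

    disjoint : ∀ {p q} → Disjoint p q → Empty (support p ∩ support q)
    disjoint {p} {q} p#q (i , i∈) =
      let i∈p , i∈q = x∈p∩q⁻ (support p) (support q) i∈
      in p#q (∈-support⁻ {p = p} i∈p , ∈-support⁻ {p = q} i∈q)

  insert : Vertex → List Vertex → List Vertex
  insert v []       = v ∷ []
  insert v (u ∷ us) with v ⟶? u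
  ... | yes _ = v ∷ u ∷ us
  ... | no  _ = u ∷ insert v us

  insert-↭ : ∀ v us → insert v us ↭ v ∷ us
  insert-↭ v []       = ↭-refl
  insert-↭ v (u ∷ us) with v ⟶? u
  ... | yes _ = ↭-refl
  ... | no  _ = ↭-trans (↭-prep u (insert-↭ v us)) (↭-swap u v ↭-refl)

  -- Every vertex passed over by `insert` has an edge to v, because v is off the path and the
  -- opposite edge was tested for and not found. The edge leaving v is the successful test that
  -- stopped the search.
  insert-linked : ∀ v {us} → v ∉ us → Linked _⟶_ us → Linked _⟶_ (insert v us)
  insert-linked v {[]}     _    _ = [-]
  insert-linked v {u ∷ us} v∉us L with v ⟶? u
  ... | yes v⟶u = v⟶u ∷ L
  ... | no ¬v⟶u = go us (v∉us ∘ there) L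
    where
    u⟶v : u ⟶ v
    u⟶v with compare u v
    ... | tri< u⟶v _ _ = u⟶v
    ... | tri≈ _ u≡v _ = contradiction (here (sym u≡v)) v∉us
    ... | tri> _ _ v⟶u = contradiction v⟶u ¬v⟶u
    go : ∀ us → v ∉ us → Linked _⟶_ (u ∷ us) → Linked _⟶_ (u ∷ insert v us)
    go []       _    _ = u⟶v ∷ [-]
    -- The list `insert v (w ∷ us)` starts with v or with w, and u has an edge to each of them.
    go (w ∷ us) v∉us (u⟶w ∷ L) with insert-linked v v∉us L
    ... | L′ with v ⟶? w
    ... | yes _ = u⟶v ∷ L′
    ... | no  _ = u⟶w ∷ L′

  -- Rédei's theorem.
  hamiltonPath : ∀ {vs} → Unique vs → ∃ λ p → p ↭ vs × Linked _⟶_ p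
  hamiltonPath []                      = [] , ↭-refl , []
  hamiltonPath {v ∷ vs} u@(_ ∷ vs!) with p , p↭vs , L ← hamiltonPath vs! =
    insert v p , ↭-trans (insert-↭ v p) (↭-prep v p↭vs) ,
    insert-linked v (Unique.Unique[x∷xs]⇒x∉xs u ∘ ∈-resp-↭ p↭vs) L

  record PathOn (P : Subset m) : Set where
    field
      path    : List Vertex
      linked  : Linked _⟶_ path
      unique  : Unique path
      support≡ : support path ≡ P

  pathOn : ∀ P → PathOn P
  pathOn P = record
    { path = p ; linked = L
    ; unique = Unique-resp-↭ (↭-sym p↭) members!
    ; support≡ = ⊆-antisym
        (λ {i} i∈ → subst (_∈ˢ P) (strictlyInverseʳ i)
          (proj₂ (∈-filter⁻ inP? {xs = vertices} (∈-resp-↭ p↭ (∈-support⁻ i∈)))))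
        (λ {i} i∈ → ∈-support⁺ (∈-resp-↭ (↭-sym p↭)
          (∈-filter⁺ inP? (∈-vertices (to i)) (subst (_∈ˢ P) (sym (strictlyInverseʳ i)) i∈))))
    }
    where
    inP? = λ v → from v ∈ˢ? P
    members! = Unique.filter⁺ inP? vertices-unique
    redei = hamiltonPath members!
    p = proj₁ redei
    p↭ = proj₁ (proj₂ redei)
    L = proj₂ (proj₂ redei)

  partition⇒pathCover : ∀ {Ps} → IsPartition Ps → ∃ λ ps → PathCover ps × map support ps ≡ Ps
  partition⇒pathCover {Ps} (nonempty , disjoint , cover) =
    ps ,
    pathCover
      (All.map⁺ (All.map inhabited nonempty))
      (All.map⁺ (All.tabulate λ {P} _ → linked (pathOn P)))
      (Unique.concat⁺ (All.map⁺ (All.tabulate λ {P} _ → unique (pathOn P)))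
        (AllPairs.map⁺ (AllPairs.map apart disjoint)))
      (λ v → ∈-concat⁺ (Any.map⁺ (Any.map (λ {P} → covered v {P}) (cover (from v))))) ,
    trans (sym (map-∘ Ps)) (trans (map-cong (support≡ ∘ pathOn) Ps) (map-id Ps))
    where
    open PathOn
    ps = map (path ∘ pathOn) Ps

    onPath : ∀ {P i} → i ∈ˢ P → to i ∈ path (pathOn P)
    onPath {P} i∈P = ∈-support⁻ (subst (_ ∈ˢ_) (sym (support≡ (pathOn P))) i∈P)

    inPart : ∀ {P v} → v ∈ path (pathOn P) → from v ∈ˢ P
    inPart {P} v∈ = subst (_ ∈ˢ_) (support≡ (pathOn P)) (∈-support-from v∈)

    inhabited : ∀ {P} → Nonempty P → path (pathOn P) ≢ []
    inhabited (i , i∈P) e with () ← subst (to i ∈_) e (onPath i∈P)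

    apart : ∀ {P Q} → Empty (P ∩ Q) → Disjoint (path (pathOn P)) (path (pathOn Q))
    apart ∩∅ (v∈p , v∈q) = ∩∅ (_ , x∈p∩q⁺ (inPart v∈p , inPart v∈q))

    covered : ∀ v {P} → from v ∈ˢ P → v ∈ path (pathOn P)
    covered v v∈ = subst (_∈ _) (strictlyInverseˡ v) (onPath v∈)

  module _ (transitive : IsTransitive T) where

    ⟶-irrefl : ∀ {v} → ¬ v ⟶ v
    ⟶-irrefl {v} v⟶v with compare v v
    ... | tri< _ v≢v _ = v≢v refl
    ... | tri≈ ¬v⟶v _ _ = ¬v⟶v v⟶v
    ... | tri> _ v≢v _ = v≢v refl

    ⟶-asym : ∀ {u v} → u ⟶ v → ¬ v ⟶ u
    ⟶-asym {u} {v} u⟶v v⟶u with compare u v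
    ... | tri< _ _ ¬v⟶u = ¬v⟶u v⟶u
    ... | tri≈ ¬u⟶v _ _ = ¬u⟶v u⟶v
    ... | tri> ¬u⟶v _ _ = ¬u⟶v u⟶v

    ⟶⇒≢ : ∀ {u v} → u ⟶ v → u ≢ v
    ⟶⇒≢ u⟶v refl = ⟶-irrefl u⟶v

    -- An edge from w to u would close a directed triangle, and `u ≡ w` would contradict asymmetry.
    ⟶-trans : ∀ {u v w} → u ⟶ v → v ⟶ w → u ⟶ w
    ⟶-trans {u} {v} {w} u⟶v v⟶w with compare u w
    ... | tri< u⟶w _ _ = u⟶w
    ... | tri≈ _ refl _ = contradiction v⟶w (⟶-asym u⟶v)
    ... | tri> _ u≢w w⟶u = contradiction
      (isDirectedCycle (λ ())
        ((⟶⇒≢ u⟶v ∷ u≢w ∷ []) ∷ (⟶⇒≢ v⟶w ∷ []) ∷ [] ∷ [])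
        (u⟶v ∷ v⟶w ∷ w⟶u ∷ []))
      (transitive (u ∷ v ∷ w ∷ []))

    -- Different heads would each lie in the tail of the other list, giving edges both ways between
    -- them. Once the heads agree, irreflexivity keeps the common head out of the tails.
    sorted-determined : ∀ {p q} → AllPairs _⟶_ p → AllPairs _⟶_ q →
      (∀ {v} → v ∈ p → v ∈ q) → (∀ {v} → v ∈ q → v ∈ p) → p ≡ q
    sorted-determined []      []      _ _ = refl
    sorted-determined []      (_ ∷ _) _ g with () ← g (here refl)
    sorted-determined (_ ∷ _) []      f _ with () ← f (here refl)
    sorted-determined {u ∷ p} {v ∷ q} (u⟶p ∷ P) (v⟶q ∷ Q) f g = cong₂ _∷_ u≡v
      (sorted-determined P Q
        (λ w∈ → tail (subst (_⟶ _) u≡v (All.lookup u⟶p w∈)) (f (there w∈)))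
        (λ w∈ → tail (subst (_⟶ _) (sym u≡v) (All.lookup v⟶q w∈)) (g (there w∈))))
      where
      u≡v : u ≡ v
      u≡v with f (here refl) | g (here refl)
      ... | here u≡v  | _         = u≡v
      ... | there _   | here v≡u  = sym v≡u
      ... | there u∈q | there v∈p =
        contradiction (All.lookup u⟶p v∈p) (⟶-asym (All.lookup v⟶q u∈q))

      tail : ∀ {x w ws} → x ⟶ w → w ∈ x ∷ ws → w ∈ ws
      tail x⟶x (here refl) = contradiction x⟶x ⟶-irrefl
      tail _   (there w∈)  = w∈

    -- By transitivity a path is a sorted list, hence determined by its set of vertices.
    paths-determined : ∀ {ps qs} → All (Linked _⟶_) ps → All (Linked _⟶_) qs →
      map support ps ≡ map support qs → ps ≡ qs
    paths-determined []       []       _ = refl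
    paths-determined {p ∷ _} {q ∷ _} (P ∷ Ps) (Q ∷ Qs) e with e₁ , e₂ ← ∷-injective e =
      cong₂ _∷_
        (sorted-determined (Linked.Linked⇒AllPairs ⟶-trans P) (Linked.Linked⇒AllPairs ⟶-trans Q)
          (transfer e₁) (transfer (sym e₁)))
        (paths-determined Ps Qs e₂)
      where
      transfer : ∀ {p q} → support p ≡ support q → ∀ {v} → v ∈ p → v ∈ q
      transfer e v∈p = subst (_∈ _) (strictlyInverseˡ _)
        (∈-support⁻ (subst (_ ∈ˢ_) e (∈-support-from v∈p)))

-- Listings that wind around the triangle

Avoids : (A → B) → List B → Set
Avoids f l = ∀ {x t} → l ≢ f x ∷ t

-- If the remainder does not start with a value of f, then `map f p` is the longest prefix made of
-- such values, and so the place of the cut is determined.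
map-++-cancel : {f : A → B} → Injective _≡_ _≡_ f → ∀ p p′ {l l′} → Avoids f l → Avoids f l′ →
  map f p ++ l ≡ map f p′ ++ l′ → p ≡ p′ × l ≡ l′
map-++-cancel inj []      []        _ _  e = refl , e
map-++-cancel inj []      (x ∷ p′) a _  e = contradiction e a
map-++-cancel inj (x ∷ p) []        _ a′ e = contradiction (sym e) a′
map-++-cancel inj (x ∷ p) (x′ ∷ p′) a a′ e with e₁ , e₂ ← ∷-injective e
  with refl ← inj e₁ | refl , e₃ ← map-++-cancel inj p p′ a a′ e₂ = refl , e₃

unique-triple⁻ : ∀ {A₁ A₂ A₃ : Set} {f : A₁ → B} {g : A₂ → B} {h : A₃ → B} xs ys {zs} →
  Unique (map f xs ++ map g ys ++ map h zs) → Unique xs × Unique ys × Unique zs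
unique-triple⁻ {f = f} {g} xs ys u =
  let xs! , u′ , _ = unique-++⁻ (map f xs) u
      ys! , zs! , _ = unique-++⁻ (map g ys) u′
  in Unique.map⁻ xs! , Unique.map⁻ ys! , Unique.map⁻ zs!

++-interchange-↭ : ∀ (a b c : List A) {w as bs cs} → w ↭ as ++ bs ++ cs →
  a ++ b ++ c ++ w ↭ (a ++ as) ++ (b ++ bs) ++ (c ++ cs)
++-interchange-↭ a b c {w} {as} {bs} {cs} e = begin
  a ++ b ++ c ++ w                     ↭⟨ ++⁺ˡ a (++⁺ˡ b (++⁺ˡ c e)) ⟩
  a ++ b ++ c ++ as ++ bs ++ cs        ↭⟨ ++⁺ˡ a (++⁺ˡ b (shifts c as)) ⟩
  a ++ b ++ as ++ c ++ bs ++ cs        ↭⟨ ++⁺ˡ a (shifts b as) ⟩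
  a ++ as ++ b ++ c ++ bs ++ cs        ↭⟨ ++⁺ˡ a (++⁺ˡ as (++⁺ˡ b (shifts c bs))) ⟩
  a ++ as ++ b ++ bs ++ c ++ cs        ≡⟨ ++-assoc a as _ ⟨
  (a ++ as) ++ b ++ bs ++ c ++ cs      ≡⟨ cong ((a ++ as) ++_) (++-assoc b bs _) ⟨
  (a ++ as) ++ (b ++ bs) ++ (c ++ cs)  ∎
  where open PermutationReasoning

↭⇒sameSet : {xs ys : List B} → xs ↭ ys → SameSet xs ys
↭⇒sameSet e = ∈-resp-↭ e , ∈-resp-↭ (↭-sym e)

module _ {A₁ A₂ A₃ : Set} where

  private
    V = A₁ ⊎ (A₂ ⊎ A₃)

  ι₁ : A₁ → V
  ι₁ = inj₁
  ι₂ : A₂ → V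
  ι₂ = inj₂ ∘ inj₁
  ι₃ : A₃ → V
  ι₃ = inj₂ ∘ inj₂

  ι₁-injective : Injective _≡_ _≡_ ι₁
  ι₁-injective refl = refl
  ι₂-injective : Injective _≡_ _≡_ ι₂
  ι₂-injective refl = refl
  ι₃-injective : Injective _≡_ _≡_ ι₃
  ι₃-injective refl = refl

  -- One turn of a Hamilton cycle around the triangle: a path in each part.
  record Turn : Set where
    constructor turn
    field
      path₁ : List A₁
      path₂ : List A₂
      path₃ : List A₃
  open Turn public

  record NonemptyTurn (t : Turn) : Set where
    constructor nonemptyTurn
    field
      nonempty₁ : path₁ t ≢ []
      nonempty₂ : path₂ t ≢ []
      nonempty₃ : path₃ t ≢ []

  weave : List Turn → List V
  weave []                     = []
  weave (turn p q r ∷ ts) = map ι₁ p ++ map ι₂ q ++ map ι₃ r ++ weave ts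

  weave-∷-++ : ∀ p q r ts l → weave (turn p q r ∷ ts) ++ l ≡
    map ι₁ p ++ map ι₂ q ++ map ι₃ r ++ weave ts ++ l
  weave-∷-++ p q r ts l = trans (++-assoc (map ι₁ p) _ l) (cong (map ι₁ p ++_)
    (trans (++-assoc (map ι₂ q) _ l) (cong (map ι₂ q ++_) (++-assoc (map ι₃ r) _ l))))

  -- Sorting the listing by parts lets distinctness and spanning pass between the whole listing and
  -- the three path covers.
  weave-↭ : ∀ ts → weave ts ↭ map ι₁ (concat (map path₁ ts))
                            ++ map ι₂ (concat (map path₂ ts)) ++ map ι₃ (concat (map path₃ ts))
  weave-↭ []                     = ↭-refl
  weave-↭ (turn p q r ∷ ts) =
    ↭-trans (++-interchange-↭ (map ι₁ p) (map ι₂ q) (map ι₃ r) (weave-↭ ts))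
      (↭-reflexive (sym (cong₂ _++_ (map-++ ι₁ p _) (cong₂ _++_ (map-++ ι₂ q _) (map-++ ι₃ r _)))))

  avoids₁-map₂ : ∀ {q l} → q ≢ [] → Avoids ι₁ (map ι₂ q ++ l)
  avoids₁-map₂ {[]}    q≢[] = contradiction refl q≢[]
  avoids₁-map₂ {_ ∷ _} _    = λ ()

  avoids₂-map₃ : ∀ {r l} → r ≢ [] → Avoids ι₂ (map ι₃ r ++ l)
  avoids₂-map₃ {[]}    r≢[] = contradiction refl r≢[]
  avoids₂-map₃ {_ ∷ _} _    = λ ()

  avoids₃-weave : ∀ {ts} → All NonemptyTurn ts → Avoids ι₃ (weave ts)
  avoids₃-weave []                                     = λ ()
  avoids₃-weave {turn [] _ _ ∷ _} (nonemptyTurn p _ _ ∷ _) = contradiction refl p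
  avoids₃-weave {turn (_ ∷ _) _ _ ∷ _} _            = λ ()

  weave≢[] : ∀ {t} ts → NonemptyTurn t → weave (t ∷ ts) ≢ []
  weave≢[] {turn []      _ _} _ (nonemptyTurn p _ _) = contradiction refl p
  weave≢[] {turn (_ ∷ _) _ _} _ _                    = λ ()

  -- Because no path is empty, each block is followed by an entry of another part or by the end of
  -- the listing, so blocks can be split off one at a time.
  weave-injective : ∀ {ts us} → All NonemptyTurn ts → All NonemptyTurn us →
    weave ts ≡ weave us → ts ≡ us
  weave-injective []       []       _ = refl
  weave-injective {us = _ ∷ us} []       (u ∷ _) e = contradiction (sym e) (weave≢[] us u)
  weave-injective {_ ∷ ts} (t ∷ _) []       e = contradiction e (weave≢[] ts t)
  weave-injective {turn p q r ∷ _} {turn p′ q′ r′ ∷ _}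
    (nonemptyTurn _ q≢ r≢ ∷ ts) (nonemptyTurn _ q′≢ r′≢ ∷ us) e
    with refl , e ← map-++-cancel ι₁-injective p p′ (avoids₁-map₂ q≢) (avoids₁-map₂ q′≢) e
    with refl , e ← map-++-cancel ι₂-injective q q′ (avoids₂-map₃ r≢) (avoids₂-map₃ r′≢) e
    with refl , e ← map-++-cancel ι₃-injective r r′ (avoids₃-weave ts) (avoids₃-weave us) e =
    cong (turn p q r ∷_) (weave-injective ts us e)

  data EndsIn₃ : List V → Set where
    last : ∀ {c} → EndsIn₃ (ι₃ c ∷ [])
    _∷_  : ∀ a {l} → EndsIn₃ l → EndsIn₃ (a ∷ l)

  ∃ι₃∈ : ∀ {l} → EndsIn₃ l → ∃ λ c → ι₃ c ∈ l
  ∃ι₃∈ last    = _ , here refl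
  ∃ι₃∈ (_ ∷ e) = let c , c∈ = ∃ι₃∈ e in c , there c∈

  endsIn₃-++ : ∀ xs {l} → EndsIn₃ l → EndsIn₃ (xs ++ l)
  endsIn₃-++ []       e = e
  endsIn₃-++ (x ∷ xs) e = x ∷ endsIn₃-++ xs e

  endsIn₃-map : ∀ {r} → r ≢ [] → EndsIn₃ (map ι₃ r)
  endsIn₃-map {[]}        r≢[] = contradiction refl r≢[]
  endsIn₃-map {c ∷ []}    _    = last
  endsIn₃-map {c ∷ d ∷ r} _    = ι₃ c ∷ endsIn₃-map {d ∷ r} λ ()

  endsIn₃-weave : ∀ {r ts} → r ≢ [] → All NonemptyTurn ts → EndsIn₃ (map ι₃ r ++ weave ts)
  endsIn₃-weave r≢[] [] = subst EndsIn₃ (sym (++-identityʳ _)) (endsIn₃-map r≢[])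
  endsIn₃-weave {r} {turn p′ q′ r′ ∷ ts} _ (nonemptyTurn _ _ r′≢[] ∷ ne) =
    endsIn₃-++ (map ι₃ r) (endsIn₃-++ (map ι₁ p′) (endsIn₃-++ (map ι₂ q′)
      (endsIn₃-weave r′≢[] ne)))

  -- If one of the lists stopped sooner, the final third-part entry of the other would fall into a
  -- block of first-part entries.
  endsIn₃-cancel : ∀ {l l′} x x′ → EndsIn₃ l → EndsIn₃ l′ →
    l ++ map ι₁ x ≡ l′ ++ map ι₁ x′ → l ≡ l′ × x ≡ x′
  endsIn₃-cancel x x′ last    last    e with e₁ , e₂ ← ∷-injective e =
    cong [_] e₁ , map-injective ι₁-injective e₂
  endsIn₃-cancel x x′ last    (_∷_ _ {l′} E) e
    with _ , c∈ ← ∃ι₃∈ E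
    with _ , _ , () ← ∈-map⁻ ι₁ (subst (_ ∈_) (sym (proj₂ (∷-injective e))) (∈-++⁺ˡ c∈))
  endsIn₃-cancel x x′ (_ ∷ E) last e
    with _ , c∈ ← ∃ι₃∈ E
    with _ , _ , () ← ∈-map⁻ ι₁ (subst (_ ∈_) (proj₂ (∷-injective e)) (∈-++⁺ˡ c∈))
  endsIn₃-cancel x x′ (_ ∷ E) (_ ∷ E′) e with e₁ , e₂ ← ∷-injective e
    with e₃ , e₄ ← endsIn₃-cancel x x′ E E′ e₂ = cong₂ _∷_ e₁ e₃ , e₄

  data Rooted (v : A₁) : List Turn → Set where
    rooted : ∀ x y q r ts → Rooted v (turn (x ++ v ∷ y) q r ∷ ts)

  weave-root : ∀ x {v} y q r ts → weave (turn (x ++ v ∷ y) q r ∷ ts) ≡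
    map ι₁ x ++ ι₁ v ∷ map ι₁ y ++ map ι₂ q ++ map ι₃ r ++ weave ts
  weave-root x {v} y q r ts =
    trans (cong (_++ _) (map-++ ι₁ x (v ∷ y))) (++-assoc (map ι₁ x) (map ι₁ (v ∷ y)) _)

  -- The arcs determine the listing from v on, and the entries of the first path that precede v
  -- are the longest suffix of that listing within the first part.
  rooted-determined : ∀ {v ts us} → Rooted v ts → Rooted v us →
    All NonemptyTurn ts → All NonemptyTurn us → Unique (weave ts) → Unique (weave us) →
    SameSet (arcs (weave ts)) (arcs (weave us)) → ts ≡ us
  rooted-determined {v} {ts} {us} (rooted x y q r ts₀) (rooted x′ y′ q′ r′ us₀)
    ne@(nonemptyTurn _ _ r≢ ∷ ne₀) ne′@(nonemptyTurn _ _ r′≢ ∷ ne₀′) ts! us! same =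
    weave-injective ne ne′
      (trans eq (trans (cong₂ (λ x l → map ι₁ x ++ ι₁ v ∷ l) x≡x′ l≡l′) (sym eq′)))
    where
    l  = map ι₁ y ++ map ι₂ q ++ map ι₃ r ++ weave ts₀
    l′ = map ι₁ y′ ++ map ι₂ q′ ++ map ι₃ r′ ++ weave us₀
    eq  = weave-root x y q r ts₀
    eq′ = weave-root x′ y′ q′ r′ us₀

    rotate! : ∀ x {l w} → w ≡ map ι₁ x ++ ι₁ v ∷ l → Unique w → Unique (ι₁ v ∷ l ++ map ι₁ x)
    rotate! x refl = Unique-resp-↭ (++-comm (map ι₁ x) _)

    rotate~ : ∀ x {l w} → w ≡ map ι₁ x ++ ι₁ v ∷ l → SameSet (arcs w) (arcs (ι₁ v ∷ l ++ map ι₁ x))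
    rotate~ x refl = ↭⇒sameSet (arcs-rotate (map ι₁ x) _)

    cancelled : l ≡ l′ × x ≡ x′
    cancelled = endsIn₃-cancel x x′
      (endsIn₃-++ (map ι₁ y) (endsIn₃-++ (map ι₂ q) (endsIn₃-weave r≢ ne₀)))
      (endsIn₃-++ (map ι₁ y′) (endsIn₃-++ (map ι₂ q′) (endsIn₃-weave r′≢ ne₀′)))
      (arcs-determined (rotate! x eq ts!) (rotate! x′ eq′ us!)
        (sameSet-trans (sameSet-sym (rotate~ x eq))
          (sameSet-trans same (rotate~ x′ eq′))))
    l≡l′ = proj₁ cancelled
    x≡x′ = proj₂ cancelled

-- Hamilton cycles of the composed tournament as triples of path covers

module _ (T₁ : Tournament m₁) (T₂ : Tournament m₂) (T₃ : Tournament m₃) where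
  private
    module T₁ = Tournament T₁
    module T₂ = Tournament T₂
    module T₃ = Tournament T₃
    T = C₃ T₁ T₂ T₃
    module T = Tournament T
    Turns = List (Turn {T₁.Vertex} {T₂.Vertex} {T₃.Vertex})

  record Covers (ts : Turns) : Set where
    constructor covers
    field
      cover₁ : PathCover T₁ (map path₁ ts)
      cover₂ : PathCover T₂ (map path₂ ts)
      cover₃ : PathCover T₃ (map path₃ ts)

  covers⇒nonempty : ∀ {ts} → Covers ts → All NonemptyTurn ts
  covers⇒nonempty {ts} (covers c₁ c₂ c₃) = go ts (nonempty c₁) (nonempty c₂) (nonempty c₃)
    where
    open PathCover
    go : ∀ (ts : Turns) → All (_≢ []) (map path₁ ts) → All (_≢ []) (map path₂ ts) →
      All (_≢ []) (map path₃ ts) → All NonemptyTurn ts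
    go []       _        _        _        = []
    go (t ∷ ts) (p ∷ ps) (q ∷ qs) (r ∷ rs) = nonemptyTurn p q r ∷ go ts ps qs rs

  covers⇒unique : ∀ {ts} → Covers ts → Unique (weave ts)
  covers⇒unique {ts} (covers c₁ c₂ c₃) = Unique-resp-↭ (↭-sym (weave-↭ ts))
    (Unique.++⁺ (Unique.map⁺ ι₁-injective (distinct c₁))
      (Unique.++⁺ (Unique.map⁺ ι₂-injective (distinct c₂)) (Unique.map⁺ ι₃-injective (distinct c₃))
        λ (p , q) → clash₂₃ (∈-map⁻ ι₂ p) (∈-map⁻ ι₃ q))
      λ (p , q) → clash₁ (∈-map⁻ ι₁ p) (∈-++⁻ (map ι₂ (concat (map path₂ ts))) q))
    where
    open PathCover
    clash₂₃ : ∀ {v : T.Vertex} {xs ys} →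
      (∃ λ x → x ∈ xs × v ≡ ι₂ x) → (∃ λ x → x ∈ ys × v ≡ ι₃ x) → ⊥
    clash₂₃ (_ , _ , refl) (_ , _ , ())
    clash₁ : ∀ {v : T.Vertex} {xs ys zs} →
      (∃ λ x → x ∈ xs × v ≡ ι₁ x) → v ∈ map ι₂ ys ⊎ v ∈ map ι₃ zs → ⊥
    clash₁ (_ , _ , refl) (inj₁ p) with _ , _ , () ← ∈-map⁻ ι₂ p
    clash₁ (_ , _ , refl) (inj₂ p) with _ , _ , () ← ∈-map⁻ ι₃ p

  covers⇒spanning : ∀ {ts} → Covers ts → ∀ v → v ∈ weave ts
  covers⇒spanning {ts} (covers c₁ c₂ c₃) v = ∈-resp-↭ (↭-sym (weave-↭ ts)) (go v)
    where
    open PathCover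
    go : ∀ v → v ∈ map ι₁ (concat (map path₁ ts))
                 ++ map ι₂ (concat (map path₂ ts)) ++ map ι₃ (concat (map path₃ ts))
    go (in₁ u) = ∈-++⁺ˡ (∈-map⁺ ι₁ (spanning c₁ u))
    go (in₂ u) = ∈-++⁺ʳ (map ι₁ (concat (map path₁ ts))) (∈-++⁺ˡ (∈-map⁺ ι₂ (spanning c₂ u)))
    go (in₃ u) = ∈-++⁺ʳ (map ι₁ (concat (map path₁ ts)))
      (∈-++⁺ʳ (map ι₂ (concat (map path₂ ts))) (∈-map⁺ ι₃ (spanning c₃ u)))

  -- The appended `ι₁ a` stands for the return to the start. It can be any vertex of `T₁`, because a
  -- nonempty sequence of turns ends in `T₃`; leaving it arbitrary is also what lets the induction
  -- run over the turns.
  weave-linked : ∀ {ts a} → All NonemptyTurn ts →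
    All (Linked T₁._⟶_) (map path₁ ts) → All (Linked T₂._⟶_) (map path₂ ts) →
    All (Linked T₃._⟶_) (map path₃ ts) → Linked T._⟶_ (weave ts ∷ʳ ι₁ a)
  weave-linked {[]} _ _ _ _ = [-]
  weave-linked {turn p q r ∷ ts} {a} (nonemptyTurn p≢ q≢ r≢ ∷ ne) (P ∷ Ps) (Q ∷ Qs) (R ∷ Rs) =
    subst (Linked T._⟶_) (sym (weave-∷-++ p q r ts (ι₁ a ∷ [])))
      (linked-++⁺ (Linked.map⁺ P)
        (linked-++⁺ (Linked.map⁺ Q)
          (linked-++⁺ (Linked.map⁺ R) (weave-linked ne Ps Qs Rs) (edge₃₁ ts ne))
          (edge₂₃ r≢))
        (edge₁₂ q≢))
    where
    edge₁₂ : ∀ {p q l} → q ≢ [] → ∀ {x y t} → x ∈ map ι₁ p → map ι₂ q ++ l ≡ y ∷ t → x T.⟶ y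
    edge₁₂ {q = []}    q≢ _  _    = contradiction refl q≢
    edge₁₂ {q = _ ∷ _} _  x∈ refl with _ , _ , refl ← ∈-map⁻ ι₁ x∈ = tt

    edge₂₃ : ∀ {q r l} → r ≢ [] → ∀ {x y t} → x ∈ map ι₂ q → map ι₃ r ++ l ≡ y ∷ t → x T.⟶ y
    edge₂₃ {r = []}    r≢ _  _    = contradiction refl r≢
    edge₂₃ {r = _ ∷ _} _  x∈ refl with _ , _ , refl ← ∈-map⁻ ι₂ x∈ = tt

    edge₃₁ : ∀ {r a} ts → All NonemptyTurn ts →
      ∀ {x y t} → x ∈ map ι₃ r → weave ts ∷ʳ ι₁ a ≡ y ∷ t → x T.⟶ y
    edge₃₁ []                           _        x∈ refl with _ , _ , refl ← ∈-map⁻ ι₃ x∈ = tt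
    edge₃₁ (turn []      _ _ ∷ _) (ne ∷ _) _  _    = contradiction refl (NonemptyTurn.nonempty₁ ne)
    edge₃₁ (turn (_ ∷ _) _ _ ∷ _) _        x∈ refl with _ , _ , refl ← ∈-map⁻ ι₃ x∈ = tt

  covers⇒hamilton : ∀ {v ts} → Rooted v ts → Covers ts → IsHamiltonCycle T (weave ts)
  covers⇒hamilton {ts = turn p q r ∷ ts} root c@(covers c₁ c₂ c₃) =
    isHamiltonCycle
      (isDirectedCycle (weave≢[] ts (All.head ne)) (covers⇒unique c)
        (edges p ne (weave-linked ne (linked c₁) (linked c₂) (linked c₃))))
      (covers⇒spanning c)
    where
    open PathCover
    ne = covers⇒nonempty c
    -- The arcs of the listing unfold only when the first path is exposed as `a ∷ p`; its head a is
    -- then the closing vertex.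
    edges : ∀ p → All NonemptyTurn (turn p q r ∷ ts) →
      (∀ {a} → Linked T._⟶_ (weave (turn p q r ∷ ts) ∷ʳ ι₁ a)) →
      All (uncurry T._⟶_) (arcs (weave (turn p q r ∷ ts)))
    edges []      (n ∷ _) _ = contradiction refl (NonemptyTurn.nonempty₁ n)
    edges (a ∷ p) _        L = linked⇒steps (ι₁ a) _ (ι₁ a) L

  weave-linked⁻ : ∀ ts → Linked T._⟶_ (weave ts) →
    All (Linked T₁._⟶_) (map path₁ ts) × All (Linked T₂._⟶_) (map path₂ ts) ×
    All (Linked T₃._⟶_) (map path₃ ts)
  weave-linked⁻ []                     _ = [] , [] , []
  weave-linked⁻ (turn p q r ∷ ts) L =
    let L₂ = linked-++⁻ʳ (map ι₁ p) L
        L₃ = linked-++⁻ʳ (map ι₂ q) L₂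
        Ps , Qs , Rs = weave-linked⁻ ts (linked-++⁻ʳ (map ι₃ r) L₃)
    in Linked.map⁻ (linked-++⁻ˡ (map ι₁ p) L) ∷ Ps ,
       Linked.map⁻ (linked-++⁻ˡ (map ι₂ q) L₂) ∷ Qs ,
       Linked.map⁻ (linked-++⁻ˡ (map ι₃ r) L₃) ∷ Rs

  hamilton⇒covers : ∀ {ts} → All NonemptyTurn ts → IsHamiltonCycle T (weave ts) → Covers ts
  hamilton⇒covers {ts} ne (isHamiltonCycle (isDirectedCycle w≢[] w! es) spanning) =
    let u₁ , u₂ , u₃ = unique-triple⁻ (concat (map path₁ ts)) (concat (map path₂ ts))
                         (Unique-resp-↭ (weave-↭ ts) w!)
        L₁ , L₂ , L₃ = weave-linked⁻ ts (linked (weave ts) es)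
    in covers
      (pathCover (All.map⁺ (All.map nonempty₁ ne)) L₁ u₁ λ v → meets₁ (sort (in₁ v)))
      (pathCover (All.map⁺ (All.map nonempty₂ ne)) L₂ u₂ λ v → meets₂ (sort (in₂ v)))
      (pathCover (All.map⁺ (All.map nonempty₃ ne)) L₃ u₃ λ v → meets₃ (sort (in₃ v)))
    where
    open NonemptyTurn
    linked : ∀ w → All (uncurry T._⟶_) (arcs w) → Linked T._⟶_ w
    linked []      _  = []
    linked (v ∷ w) es = linked-++⁻ˡ (v ∷ w) (steps⇒linked v w v es)

    Sorted : T.Vertex → Set
    Sorted v = v ∈ map ι₁ (concat (map path₁ ts)) ⊎
               v ∈ map ι₂ (concat (map path₂ ts)) ⊎ v ∈ map ι₃ (concat (map path₃ ts))

    sort : ∀ v → Sorted v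
    sort v = Sum.map₂ (∈-++⁻ (map ι₂ (concat (map path₂ ts))))
      (∈-++⁻ (map ι₁ (concat (map path₁ ts))) (∈-resp-↭ (weave-↭ ts) (spanning v)))

    meets₁ : ∀ {v} → Sorted (in₁ v) → v ∈ concat (map path₁ ts)
    meets₁ (in₁ p) with _ , p , refl ← ∈-map⁻ ι₁ p = p
    meets₁ (in₂ p) with _ , _ , () ← ∈-map⁻ ι₂ p
    meets₁ (in₃ p) with _ , _ , () ← ∈-map⁻ ι₃ p

    meets₂ : ∀ {v} → Sorted (in₂ v) → v ∈ concat (map path₂ ts)
    meets₂ (in₁ p) with _ , _ , () ← ∈-map⁻ ι₁ p
    meets₂ (in₂ p) with _ , p , refl ← ∈-map⁻ ι₂ p = p
    meets₂ (in₃ p) with _ , _ , () ← ∈-map⁻ ι₃ p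

    meets₃ : ∀ {v} → Sorted (in₃ v) → v ∈ concat (map path₃ ts)
    meets₃ (in₁ p) with _ , _ , () ← ∈-map⁻ ι₁ p
    meets₃ (in₂ p) with _ , _ , () ← ∈-map⁻ ι₂ p
    meets₃ (in₃ p) with _ , p , refl ← ∈-map⁻ ι₃ p = p

  -- The shape of a walk that is about to return to the first part.
  data Parse : List T.Vertex → Set where
    end   : ∀ s → Parse (map ι₁ s)
    from₁ : ∀ a p b q c r ts s → All NonemptyTurn ts → Parse
      (map ι₁ (a ∷ p) ++ map ι₂ (b ∷ q) ++ map ι₃ (c ∷ r) ++ weave ts ++ map ι₁ s)
    from₂ : ∀ b q c r ts s → All NonemptyTurn ts → Parse
      (map ι₂ (b ∷ q) ++ map ι₃ (c ∷ r) ++ weave ts ++ map ι₁ s)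
    from₃ : ∀ c r ts s → All NonemptyTurn ts → Parse
      (map ι₃ (c ∷ r) ++ weave ts ++ map ι₁ s)

  -- The walk is read from its end. A new entry in front either extends the leading block or opens a
  -- block of the preceding part; the remaining cases would need an edge against the orientation of
  -- the triangle.
  parse : ∀ {a} l → Linked T._⟶_ (l ∷ʳ ι₁ a) → Parse l
  parse []      _ = end []
  parse (u ∷ l) L with parse l (Linked.tail L)
  parse (in₁ u ∷ _) _        | end s                        = end (u ∷ s)
  parse (in₁ u ∷ _) _        | from₁ a p b q c r ts s ne    = from₁ u (a ∷ p) b q c r ts s ne
  parse (in₁ u ∷ _) _        | from₂ b q c r ts s ne        = from₁ u [] b q c r ts s ne
  parse (in₁ u ∷ _) (() ∷ _) | from₃ c r ts s ne
  -- Here the forbidden edge goes from u to the appended vertex `ι₁ a`.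
  parse (in₂ u ∷ _) (() ∷ _) | end []
  parse (in₂ u ∷ _) (() ∷ _) | end (_ ∷ _)
  parse (in₂ u ∷ _) (() ∷ _) | from₁ a p b q c r ts s ne
  parse (in₂ u ∷ _) _        | from₂ b q c r ts s ne        = from₂ u (b ∷ q) c r ts s ne
  parse (in₂ u ∷ _) _        | from₃ c r ts s ne            = from₂ u [] c r ts s ne
  parse (in₃ u ∷ _) _        | end s                        = from₃ u [] [] s []
  -- A third-part entry in front of a first-part block marks that block as the start of a complete
  -- turn, which joins `ts`.
  parse (in₃ u ∷ _) _        | from₁ a p b q c r ts s ne    =
    subst Parse (cong (in₃ u ∷_) (weave-∷-++ (a ∷ p) (b ∷ q) (c ∷ r) ts (map ι₁ s)))
      (from₃ u [] (turn (a ∷ p) (b ∷ q) (c ∷ r) ∷ ts) s (nonemptyTurn (λ ()) (λ ()) (λ ()) ∷ ne))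
  parse (in₃ u ∷ _) (() ∷ _) | from₂ b q c r ts s ne
  parse (in₃ u ∷ _) _        | from₃ c r ts s ne            = from₃ u (c ∷ r) ts s ne

  record Rotation (v : T₁.Vertex) (w : List T.Vertex) : Set where
    field
      turns   : Turns
      root    : Rooted v turns
      isCover : Covers turns
      sameArcs : SameSet (arcs (weave turns)) (arcs w)

  -- Rotating the cycle to start at v makes it parsable. The trailing first-part entries s of the
  -- parse are the vertices that precede v on its path, and a second rotation moves them to the
  -- front.
  rooted-rotation : T₂.Vertex → ∀ v w → IsHamiltonCycle T w → Rotation v w
  rooted-rotation u v w ham@(isHamiltonCycle _ spanning)
    with x , y , refl ← ∈-∃++ (spanning (in₁ v)) =
    go (parse (in₁ v ∷ y ++ x) (closing (hamilton-rotate T x (in₁ v ∷ y) ham))) refl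
      (hamilton-rotate T x (in₁ v ∷ y) ham) (↭⇒sameSet (arcs-rotate (in₁ v ∷ y) x))
    where
    closing : ∀ {z} → IsHamiltonCycle T (in₁ v ∷ z) → Linked T._⟶_ ((in₁ v ∷ z) ∷ʳ in₁ v)
    closing (isHamiltonCycle (isDirectedCycle _ _ es) _) = steps⇒linked (in₁ v) _ (in₁ v) es

    go : ∀ {l z w} → Parse l → l ≡ in₁ v ∷ z → IsHamiltonCycle T l → SameSet (arcs l) (arcs w) →
      Rotation v w
    -- A cycle that never left `T₁` would miss the vertex u of `T₂`.
    go (end s) _ (isHamiltonCycle _ spanning) _ with _ , _ , () ← ∈-map⁻ ι₁ (spanning (in₂ u))
    go (from₁ a p b q c r ts s ne) refl ham same = record
      { turns = turns ; root = rooted s p _ _ _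
      ; isCover = hamilton⇒covers ne′ (subst (IsHamiltonCycle T) (sym weave≡)
          (hamilton-rotate T l (map ι₁ s) (subst (IsHamiltonCycle T) assoc ham)))
      ; sameArcs = sameSet-trans (sameSet-trans
          (subst (λ w → SameSet (arcs w) (arcs (map ι₁ s ++ l))) (sym weave≡) sameSet-refl)
          (subst (λ w → SameSet (arcs (map ι₁ s ++ l)) (arcs w)) (sym assoc)
            (↭⇒sameSet (arcs-rotate (map ι₁ s) l))))
          same
      }
      where
      l = weave (turn (a ∷ p) (b ∷ q) (c ∷ r) ∷ ts)
      turns = turn (s ++ a ∷ p) (b ∷ q) (c ∷ r) ∷ ts
      assoc = sym (weave-∷-++ (a ∷ p) (b ∷ q) (c ∷ r) ts (map ι₁ s))
      weave≡ = weave-root s p (b ∷ q) (c ∷ r) ts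
      s++a∷p≢[] : ∀ s → s ++ a ∷ p ≢ []
      s++a∷p≢[] []      ()
      s++a∷p≢[] (_ ∷ _) ()
      ne′ : All NonemptyTurn turns
      ne′ = nonemptyTurn (s++a∷p≢[] s) (λ ()) (λ ()) ∷ ne

-- Cycles and shapes

length-concatMap-sum : (f : A → List B) (xs : List A) →
  length (concatMap f xs) ≡ sum (map (length ∘ f) xs)
length-concatMap-sum f []       = refl
length-concatMap-sum f (x ∷ xs) =
  trans (length-++ (f x)) (cong (length (f x) +_) (length-concatMap-sum f xs))

length-cartesianProduct : (xs : List A) (ys : List B) →
  length (cartesianProduct xs ys) ≡ length xs * length ys
length-cartesianProduct []       ys = refl
length-cartesianProduct (x ∷ xs) ys = trans (length-++ (map (x ,_) ys))
  (cong₂ _+_ (length-map (x ,_) ys) (length-cartesianProduct xs ys))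

zipTurns : {ps : List (List A)} {qs : List (List B)} {rs : List (List C)} →
  length ps ≡ length qs → length qs ≡ length rs →
  ∃ λ ts → map path₁ ts ≡ ps × map path₂ ts ≡ qs × map path₃ ts ≡ rs
zipTurns {ps = []}    {[]}    {[]}    _ _ = [] , refl , refl , refl
zipTurns {ps = p ∷ ps} {q ∷ qs} {r ∷ rs} e f
  with ts , refl , refl , refl ←
    zipTurns {ps = ps} {qs} {rs} (suc-injective e) (suc-injective f) =
  turn p q r ∷ ts , refl , refl , refl

turns-determined : {ts us : List (Turn {A} {B} {C})} → map path₁ ts ≡ map path₁ us →
  map path₂ ts ≡ map path₂ us → map path₃ ts ≡ map path₃ us → ts ≡ us
turns-determined {ts = []}    {[]}    _ _ _ = refl
turns-determined {ts = turn p q r ∷ _} {turn _ _ _ ∷ _} e f g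
  with refl , e ← ∷-injective e | refl , f ← ∷-injective f | refl , g ← ∷-injective g =
  cong (turn p q r ∷_) (turns-determined e f g)

-- Since `k !` is `k * j !`, one factor k can be drawn out of the cube, which makes the division
-- exact with quotient `j ! * (k ! * k !)`.
term-factorisation : ∀ a b c j → let k = suc j in
  a * j ! * (b * k ! * (c * k !)) ≡ a * b * c * ((k !) ^ 3 / k)
term-factorisation a b c j = trans (rearrange a b c (j !) (suc j !))
  (cong (a * b * c *_) (sym (trans (/-congˡ {o = suc j} (cube (suc j) (j !))) (m*n/n≡m _ (suc j)))))
  where
  open +-*-Solver
  rearrange : ∀ a b c f g → a * f * (b * g * (c * g)) ≡ a * b * c * (f * (g * g))
  rearrange = solve 5 (λ a b c f g →
    a :* f :* (b :* g :* (c :* g)) := a :* b :* c :* (f :* (g :* g))) refl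
  cube : ∀ k f → (k * f) ^ 3 ≡ f * ((k * f) * (k * f)) * k
  cube = solve 2 (λ k f → (k :* f) :^ 3 := f :* ((k :* f) :* (k :* f)) :* k) refl

module _ {m₁ m₂ m₃ : ℕ} (T₁ : Tournament m₁) (T₂ : Tournament m₂) (T₃ : Tournament m₃)
         (i₀ : Fin m₁) (u₀ : Tournament.Vertex T₂) where
  private
    module T₁ = Tournament T₁
    module T₂ = Tournament T₂
    module T₃ = Tournament T₃
    T = C₃ T₁ T₂ T₃
    module T = Tournament T
    Turns = List (Turn {T₁.Vertex} {T₂.Vertex} {T₃.Vertex})
    Shape = List (Subset m₁) × List (Subset m₂) × List (Subset m₃)
    v₀ = Inverse.to T₁.finite i₀
    arcs? = sameSet? (Product.≡-dec T._≟_ T._≟_)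

  cycles : List (List (T.Vertex × T.Vertex))
  cycles = deduplicate arcs? (map arcs (hamiltonListings T))

  shape : Turns → Shape
  shape ts = map (support T₁) (map path₁ ts) , map (support T₂) (map path₂ ts) ,
             map (support T₃) (map path₃ ts)

  shapesOfSize : ℕ → List Shape
  shapesOfSize k =
    cartesianProduct (rootedPartitions i₀ k) (cartesianProduct (partitions k) (partitions k))

  shapes : List Shape
  shapes = concatMap (shapesOfSize ∘ suc) (upTo (m₁ ⊓ m₂ ⊓ m₃))

  record IsShape (k : ℕ) (d : Shape) : Set where
    constructor isShape
    field
      part₁ : proj₁ d ∈ rootedPartitions i₀ k
      part₂ : proj₁ (proj₂ d) ∈ partitions k
      part₃ : proj₂ (proj₂ d) ∈ partitions k

  ∈-shapesOfSize⁻ : ∀ {k d} → d ∈ shapesOfSize k → IsShape k d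
  ∈-shapesOfSize⁻ {k} d∈ =
    let p₁ , d∈ = ∈-cartesianProduct⁻ (rootedPartitions i₀ k) _ d∈
        p₂ , p₃ = ∈-cartesianProduct⁻ (partitions k) (partitions k) d∈
    in isShape p₁ p₂ p₃

  ∈-rooted⁻ : ∀ {k Ps} → Ps ∈ rootedPartitions i₀ k → length Ps ≡ k × IsPartition Ps × InFirst i₀ Ps
  ∈-rooted⁻ {k} Ps∈ =
    let Ps∈ , root = ∈-filter⁻ (inFirst? i₀) {xs = partitions k} Ps∈
        |Ps| , isP = ∈-partitions⁻ {k = k} Ps∈
    in |Ps| , isP , root

  shapes-unique : Unique shapes
  shapes-unique = concatMap-unique (shapesOfSize ∘ suc) (Unique.upTo⁺ (m₁ ⊓ m₂ ⊓ m₃))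
    (λ {j} _ → Unique.cartesianProduct⁺ (Unique.filter⁺ (inFirst? i₀) (partitions-unique (suc j)))
      (Unique.cartesianProduct⁺ (partitions-unique (suc j)) (partitions-unique (suc j))))
    λ {j} {j′} _ _ p q j≢j′ → j≢j′ (suc-injective (trans
      (sym (proj₁ (∈-rooted⁻ {suc j} (IsShape.part₁ (∈-shapesOfSize⁻ {suc j} p)))))
      (proj₁ (∈-rooted⁻ {suc j′} (IsShape.part₁ (∈-shapesOfSize⁻ {suc j′} q))))))

  length-shapes : length shapes ≡
    sum (map (λ j → let k = suc j in S m₁ k * S m₂ k * S m₃ k * ((k !) ^ 3 / k))
             (upTo (m₁ ⊓ m₂ ⊓ m₃)))
  length-shapes = trans (length-concatMap-sum (shapesOfSize ∘ suc) (upTo (m₁ ⊓ m₂ ⊓ m₃)))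
    (cong sum (map-cong size (upTo (m₁ ⊓ m₂ ⊓ m₃))))
    where
    size : ∀ j → let k = suc j in
      length (shapesOfSize k) ≡ S m₁ k * S m₂ k * S m₃ k * ((k !) ^ 3 / k)
    size j = begin
      length (shapesOfSize (suc j))
        ≡⟨ length-cartesianProduct (rootedPartitions i₀ (suc j)) _ ⟩
      length (rootedPartitions i₀ (suc j)) *
        length (cartesianProduct (partitions {m₂} (suc j)) (partitions {m₃} (suc j)))
        ≡⟨ cong₂ _*_ (length-rootedPartitions i₀ j)
             (trans (length-cartesianProduct (partitions {m₂} (suc j)) (partitions {m₃} (suc j)))
               (cong₂ _*_ (length-partitions {m₂} (suc j)) (length-partitions {m₃} (suc j)))) ⟩
      S m₁ (suc j) * j ! * (S m₂ (suc j) * suc j ! * (S m₃ (suc j) * suc j !))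
        ≡⟨ term-factorisation (S m₁ (suc j)) (S m₂ (suc j)) (S m₃ (suc j)) j ⟩
      S m₁ (suc j) * S m₂ (suc j) * S m₃ (suc j) * ((suc j !) ^ 3 / suc j) ∎
      where open ≡-Reasoning

  -- The turns are a hidden witness linking a shape to a cycle. Arcs are compared as sets, because
  -- the representative that `deduplicate` keeps may come from another rotation of the listing.
  record HasShape (d : Shape) (a : List (T.Vertex × T.Vertex)) : Set where
    constructor hasShape
    field
      turns    : Turns
      root     : Rooted v₀ turns
      isCover  : Covers T₁ T₂ T₃ turns
      shape≡   : shape turns ≡ d
      sameArcs : SameSet (arcs (weave turns)) a

  inFirst⇒rooted : ∀ (ts : Turns) → InFirst i₀ (map (support T₁) (map path₁ ts)) → Rooted v₀ ts
  inFirst⇒rooted (turn p q r ∷ ts) (first i₀∈)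
    with x , y , refl ← ∈-∃++ (∈-support⁻ T₁ {p = p} i₀∈) = rooted x y q r ts

  rooted⇒inFirst : ∀ {ts : Turns} → Rooted v₀ ts → InFirst i₀ (map (support T₁) (map path₁ ts))
  rooted⇒inFirst (rooted x y q r ts) =
    first (∈-support⁺ T₁ {p = x ++ v₀ ∷ y} (∈-++⁺ʳ x (here refl)))

  private
    length-map⁻ : ∀ {A B : Set} {f : A → B} {k} xs → length (map f xs) ≡ k → length xs ≡ k
    length-map⁻ xs e = trans (sym (length-map _ xs)) e

  realise-covers : ∀ ts → Rooted v₀ ts → Covers T₁ T₂ T₃ ts →
    ∃ λ a → a ∈ cycles × HasShape (shape ts) a
  realise-covers ts root c =
    let a , a∈ , same = deduplicate-complete arcs? sameSet-refl sameSet-trans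
          (∈-map⁺ arcs (∈-hamiltonListings T (covers⇒hamilton T₁ T₂ T₃ root c)))
    in a , a∈ , hasShape ts root c refl (sameSet-sym same)

  realise : ∀ {d} → d ∈ shapes → ∃ λ a → a ∈ cycles × HasShape d a
  realise {d} d∈
    with j , _ , d∈ ← find (∈-concatMap⁻ (shapesOfSize ∘ suc) {upTo (m₁ ⊓ m₂ ⊓ m₃)} d∈)
    with isShape p₁ p₂ p₃ ← ∈-shapesOfSize⁻ {suc j} d∈
    with |Ps| , isP , root ← ∈-rooted⁻ {suc j} p₁
    with |Qs| , isQ ← ∈-partitions⁻ {k = suc j} p₂
    with |Rs| , isR ← ∈-partitions⁻ {k = suc j} p₃
    with ps , c₁ , refl ← partition⇒pathCover T₁ isP
    with qs , c₂ , refl ← partition⇒pathCover T₂ isQ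
    with rs , c₃ , refl ← partition⇒pathCover T₃ isR
    with ts , refl , refl , refl ← zipTurns {ps = ps} {qs} {rs}
      (trans (length-map⁻ ps |Ps|) (sym (length-map⁻ qs |Qs|)))
      (trans (length-map⁻ qs |Qs|) (sym (length-map⁻ rs |Rs|)))
    = realise-covers ts (inFirst⇒rooted ts root) (covers c₁ c₂ c₃)

  hasShape-determined : ∀ {d d′ a} → HasShape d a → HasShape d′ a → d ≡ d′
  hasShape-determined (hasShape ts root c refl same) (hasShape us root′ c′ refl same′) =
    cong shape (rooted-determined root root′
      (covers⇒nonempty T₁ T₂ T₃ c) (covers⇒nonempty T₁ T₂ T₃ c′)
      (covers⇒unique T₁ T₂ T₃ c) (covers⇒unique T₁ T₂ T₃ c′)
      (sameSet-trans same (sameSet-sym same′)))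

  shapes≤cycles : length shapes ≤ length cycles
  shapes≤cycles = pigeonhole {R = HasShape} shapes-unique realise
    λ _ _ r r′ d≢d′ → d≢d′ (hasShape-determined r r′)

  shapeOf : ∀ {a} → a ∈ cycles → ∃ λ d → d ∈ shapes × HasShape d a
  shapeOf a∈
    with w , w∈ , refl ← ∈-map⁻ arcs (∈-deduplicate⁻ arcs? (map arcs (hamiltonListings T)) a∈)
    with _ , ham ← ∈-filter⁻ (isHamiltonCycle? T) {xs = words (m₁ + (m₂ + m₃)) T.vertices} w∈
    -- `Rooted` rules out an empty list of turns. Their number is thus `suc j` with j the length of
    -- `ts`, and the bounds on `suc j` are exactly what membership of j in `upTo` requires.
    with record { turns = t ∷ ts ; root = root ; isCover = c@(covers c₁ c₂ c₃) ; sameArcs = same } ←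
      rooted-rotation T₁ T₂ T₃ u₀ v₀ w ham =
    shape (t ∷ ts) ,
    ∈-concatMap⁺ (shapesOfSize ∘ suc) (lose (∈-upTo⁺ (⊓-glb (⊓-glb
      (bound size₁ isP) (bound size₂ isQ)) (bound size₃ isR)))
      (∈-cartesianProduct⁺ (∈-filter⁺ (inFirst? i₀) (member size₁ isP) (rooted⇒inFirst root))
        (∈-cartesianProduct⁺ (member size₂ isQ) (member size₃ isR)))) ,
    hasShape (t ∷ ts) root c refl same
    where
    isP = pathCover⇒partition T₁ c₁
    isQ = pathCover⇒partition T₂ c₂
    isR = pathCover⇒partition T₃ c₃

    size : ∀ {A B C : Set} (g : B → C) (f : A → B) xs → length (map g (map f xs)) ≡ length xs
    size g f xs = trans (length-map g (map f xs)) (length-map f xs)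
    size₁ = size (support T₁) path₁ (t ∷ ts)
    size₂ = size (support T₂) path₂ (t ∷ ts)
    size₃ = size (support T₃) path₃ (t ∷ ts)

    bound : ∀ {m k} {Ps : List (Subset m)} → length Ps ≡ k → IsPartition Ps → k ≤ m
    bound e isP = ≤-trans (≤-reflexive (sym e)) (partition-size isP)

    member : ∀ {m k} {Ps : List (Subset m)} → length Ps ≡ k → IsPartition Ps → Ps ∈ partitions k
    member refl isP = ∈-partitions⁺ isP

  module _ (trans₁ : IsTransitive T₁) (trans₂ : IsTransitive T₂) (trans₃ : IsTransitive T₃) where

    shape-injective : ∀ {ts us} → Covers T₁ T₂ T₃ ts → Covers T₁ T₂ T₃ us →
      shape ts ≡ shape us → ts ≡ us
    shape-injective (covers c₁ c₂ c₃) (covers c₁′ c₂′ c₃′) e =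
      turns-determined
        (paths-determined T₁ trans₁ (linked c₁) (linked c₁′) (cong proj₁ e))
        (paths-determined T₂ trans₂ (linked c₂) (linked c₂′) (cong (proj₁ ∘ proj₂) e))
        (paths-determined T₃ trans₃ (linked c₃) (linked c₃′) (cong (proj₂ ∘ proj₂) e))
      where open PathCover

    cycles≤shapes : length cycles ≤ length shapes
    cycles≤shapes = pigeonhole {R = λ a d → HasShape d a}
      (deduplicate-separated arcs? (map arcs (hamiltonListings T))) shapeOf
      λ { _ _ (hasShape ts _ c e same) (hasShape us _ c′ e′ same′) a≁a′ →
          a≁a′ (sameSet-trans (sameSet-sym same)
            (subst (λ ts → SameSet (arcs (weave ts)) _)
              (sym (shape-injective c c′ (trans e (sym e′)))) same′)) }

theorem1 : (m₁ m₂ m₃ : ℕ) → m₁ ≥ 1 → m₂ ≥ 1 → m₃ ≥ 1 →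
    (T₁ : Tournament m₁) (T₂ : Tournament m₂) (T₃ : Tournament m₃) →
    let H     = #HamiltonCycles (C₃ T₁ T₂ T₃)
        term  = λ j → let k = suc j in
                  S m₁ k * S m₂ k * S m₃ k * ((k !) ^ 3 / k)
        bound = sum (map term (upTo (m₁ ⊓ m₂ ⊓ m₃)))
    in (H ≥ bound)
       × (IsTransitive T₁ → IsTransitive T₂ → IsTransitive T₃ → H ≡ bound)
theorem1 m₁ m₂ m₃ m₁≥1 m₂≥1 _ T₁ T₂ T₃ =
  ≤-trans (≤-reflexive (sym size)) (shapes≤cycles T₁ T₂ T₃ i₀ u₀) ,
  λ t₁ t₂ t₃ → trans
    (≤-antisym (cycles≤shapes T₁ T₂ T₃ i₀ u₀ t₁ t₂ t₃) (shapes≤cycles T₁ T₂ T₃ i₀ u₀)) size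
  where
  -- `i₀` is the index of the root vertex in `T₁`; `u₀` is the vertex of `T₂` that forces every
  -- Hamilton cycle out of `T₁`.
  i₀   = fromℕ< m₁≥1
  u₀   = Inverse.to (Tournament.finite T₂) (fromℕ< m₂≥1)
  size = length-shapes T₁ T₂ T₃ i₀ u₀
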